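{- Let $m\ge n\ge o\ge 0$ be integers with $m+n+o\ge 4$ such that the complete tripartite graph $K_{m,n,o}$ is connected. Let the vertices of the parts of sizes $m,n,o$ carry the indeterminates $x_1,\dots,x_m$, $y_1,\dots,y_n$, $z_1,\dots,z_o$ respectively. Then the third critical ideal $I_3=I_3(K_{m,n,o},\{X,Y,Z\})\subseteq\mathbb{Z}[x_1,\dots,x_m,y_1,\dots,y_n,z_1,\dots,z_o]$ is: - $\langle 2, x_1,\dots,x_m, y_1,\dots,y_n, z_1,\dots,z_o\rangle$ if $m,n,o\ge 2$; - $\langle x_1,\dots,x_m, y_1,\dots,y_n, z_1+2\rangle$ if $m\ge2$, $n\ge 2$, $o=1$; - $\langle x_1,\dots,x_m, y_1+z_1+2\rangle$ if $m\ge 3$, $n=1$, $o=1$; - $\langle x_1x_2+x_1+x_2,\ x_1z_1+x_1,\ x_2z_1+x_2,\ y_1+z_1+2\rangle$ if $m=2$, $n=1$, $o=1$; - $\langle x_1,\dots,x_m, y_1,\dots,y_n\rangle$ if $m\ge 3$, $n\ge 3$, $o=0$; - $\langle x_1,\dots,x_m, y_1+y_2\rangle$ if $m\ge 3$, $n=2$, $o=0$; - $\langle x_2y_2,\ x_1+x_2,\ y_1+y_2\rangle$ if $m=2$, $n=2$, $o=0$; - $\langle x_1,\dots,x_m\rangle$ if $m\ge 3$, $n=1$, $o=0$.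
   Context: For a finite graph $G$ with an indeterminate $x_u$ for each vertex $u$, the generalized Laplacian matrix $L(G,X_G)$ is the matrix indexed by $V(G)$ with $(u,u)$-entry $x_u$ and $(u,v)$-entry $-m_{uv}$ for $u\ne v$, $m_{uv}$ being the number of edges between $u$ and $v$. The third critical ideal $I_3(G,X_G)$ is the ideal of $\mathbb{Z}[X_G]$ generated by all $3\times 3$ minors of $L(G,X_G)$. $K_{m,n,o}$ is the complete tripartite graph with parts of sizes $m,n,o$ (for $o=0$ it is the complete bipartite graph $K_{m,n}$). -}

module Defs where

open import Algebra.Bundles using (CommutativeRing)
open import Algebra.Structures using (IsCommutativeRing)
open import Data.Bool.Base using (true; false; if_then_else_)
open import Data.Fin.Base as Fin using (Fin; zero; suc; toℕ; _↑ˡ_; _↑ʳ_; punchIn; splitAt)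
import Data.Fin.Properties as Fin
open import Data.Fin.Patterns using (0F; 1F; 2F)
open import Data.Integer.Base as ℤ using (ℤ; 0ℤ; 1ℤ)
import Data.Integer.Properties as ℤ
open import Data.List.Base using (List; []; _∷_; _++_; [_]; map; tabulate)
open import Data.List.Membership.Propositional using (_∈_)
open import Data.Nat.Base as ℕ using (ℕ; zero; suc)
import Data.Nat.Properties as ℕ
open import Data.Product.Base using (_×_; _,_; ∃₂)
open import Data.Sum.Base using ([_,_]′)
open import Data.Vec.Base as Vec using (Vec; zipWith; replicate; _[_]≔_)
import Data.Vec.Properties as Vec
open import Function.Base using (_∘_; const)
open import Level using (Level; _⊔_)
open import Relation.Binary.Construct.Closure.ReflexiveTransitive using (Star)
open import Relation.Binary.Definitions using (Monotonic₁)
open import Relation.Binary.PropositionalEquality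
  using (_≡_; _≢_; refl; sym; trans; cong; cong₂; module ≡-Reasoning)
open import Relation.Nullary using (Dec; yes; no; does)
open import Relation.Nullary.Decidable using (dec-true; dec-false)
open import Relation.Unary using (Pred)

private variable
  a ℓ p : Level
  N : ℕ

-- The monomial Π Xᵢ^αᵢ as its exponent vector α.
Monomial : ℕ → Set
Monomial N = Vec ℕ N

_≟ᵐ_ : (α β : Monomial N) → Dec (α ≡ β)
_≟ᵐ_ = Vec.≡-dec ℕ._≟_

_∙_ : Monomial N → Monomial N → Monomial N
_∙_ = zipWith ℕ._+_

-- Formal sums of terms c·X^α. A monomial may be repeated, and coefficients may
-- vanish; two sums are equal as polynomials when all coefficients agree (_≈_).
Poly : ℕ → Set
Poly N = List (ℤ × Monomial N)

coeff : Poly N → Monomial N → ℤ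
coeff []            μ = 0ℤ
coeff ((c , α) ∷ f) μ = (if does (α ≟ᵐ μ) then c else 0ℤ) ℤ.+ coeff f μ

-- A record, so that f and g can be inferred from the type f ≈ g.
infix 4 _≈_
record _≈_ (f g : Poly N) : Set where
  constructor mk≈
  field coeff≡ : ∀ μ → coeff f μ ≡ coeff g μ
open _≈_ public

infixl 6 _+_
infixl 7 _*_
infix  8 -_

_+_ : Poly N → Poly N → Poly N
_+_ = _++_

-_ : Poly N → Poly N
-_ = map λ (c , α) → ℤ.- c , α

_*ₜ_ : ℤ × Monomial N → Poly N → Poly N
(c , α) *ₜ g = map (λ (d , β) → c ℤ.* d , α ∙ β) g

_*_ : Poly N → Poly N → Poly N
[]      * g = []
(t ∷ f) * g = t *ₜ g + f * g

con : ℤ → Poly N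
con {N} c = [ c , replicate N 0 ]

X : Fin N → Poly N
X {N} i = [ 1ℤ , replicate N 0 [ i ]≔ 1 ]

0# 1# : Poly N
0# = []
1# = con 1ℤ

private
  module Laws {N : ℕ} where
    open ≡-Reasoning

    ∙-assoc : (α β γ : Monomial N) → (α ∙ β) ∙ γ ≡ α ∙ (β ∙ γ)
    ∙-assoc = Vec.zipWith-assoc ℕ.+-assoc

    ∙-comm : (α β : Monomial N) → α ∙ β ≡ β ∙ α
    ∙-comm = Vec.zipWith-comm ℕ.+-comm

    ∙-identityˡ : (α : Monomial N) → replicate N 0 ∙ α ≡ α
    ∙-identityˡ = Vec.zipWith-identityˡ ℕ.+-identityˡ

    _∸ᵐ_ : ∀ {n} → Monomial n → Monomial n → Monomial n
    _∸ᵐ_ = zipWith ℕ._∸_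

    ∙-∸ : ∀ {n} (α β : Monomial n) → (α ∙ β) ∸ᵐ β ≡ α
    ∙-∸ Vec.[]       Vec.[]       = refl
    ∙-∸ (i Vec.∷ α) (j Vec.∷ β) = cong₂ Vec._∷_ (ℕ.m+n∸n≡m i j) (∙-∸ α β)

    -- Every linear functional on polynomials is Σ c·X^α ↦ Σ c·φ(α).
    pair : Poly N → (Monomial N → ℤ) → ℤ
    pair []            φ = 0ℤ
    pair ((c , α) ∷ f) φ = c ℤ.* φ α ℤ.+ pair f φ

    δ : Monomial N → Monomial N → ℤ
    δ μ α = if does (α ≟ᵐ μ) then 1ℤ else 0ℤ

    coeff-pair : ∀ f μ → coeff f μ ≡ pair f (δ μ)
    coeff-pair []            μ = refl
    coeff-pair ((c , α) ∷ f) μ = cong₂ ℤ._+_ (lem (does (α ≟ᵐ μ))) (coeff-pair f μ)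
      where
      lem : ∀ b → (if b then c else 0ℤ) ≡ c ℤ.* (if b then 1ℤ else 0ℤ)
      lem true  = sym (ℤ.*-identityʳ c)
      lem false = sym (ℤ.*-zeroʳ c)

    pair-cong : ∀ f {φ ψ} → (∀ α → φ α ≡ ψ α) → pair f φ ≡ pair f ψ
    pair-cong []            e = refl
    pair-cong ((c , α) ∷ f) e = cong₂ ℤ._+_ (cong (c ℤ.*_) (e α)) (pair-cong f e)

    pair-0 : ∀ f → pair f (const 0ℤ) ≡ 0ℤ
    pair-0 []            = refl
    pair-0 ((c , α) ∷ f) = cong₂ ℤ._+_ (ℤ.*-zeroʳ c) (pair-0 f)

    interchange : ∀ i j k l → (i ℤ.+ j) ℤ.+ (k ℤ.+ l) ≡ (i ℤ.+ k) ℤ.+ (j ℤ.+ l)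
    interchange i j k l = begin
      (i ℤ.+ j) ℤ.+ (k ℤ.+ l)   ≡⟨ ℤ.+-assoc i j _ ⟩
      i ℤ.+ (j ℤ.+ (k ℤ.+ l))   ≡⟨ cong (λ s → i ℤ.+ s) (sym (ℤ.+-assoc j k l)) ⟩
      i ℤ.+ ((j ℤ.+ k) ℤ.+ l)   ≡⟨ cong (λ s → i ℤ.+ (s ℤ.+ l)) (ℤ.+-comm j k) ⟩
      i ℤ.+ ((k ℤ.+ j) ℤ.+ l)   ≡⟨ cong (λ s → i ℤ.+ s) (ℤ.+-assoc k j l) ⟩
      i ℤ.+ (k ℤ.+ (j ℤ.+ l))   ≡⟨ sym (ℤ.+-assoc i k _) ⟩
      (i ℤ.+ k) ℤ.+ (j ℤ.+ l)   ∎

    pair-+ : ∀ f φ ψ → pair f (λ α → φ α ℤ.+ ψ α) ≡ pair f φ ℤ.+ pair f ψ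
    pair-+ []            φ ψ = refl
    pair-+ ((c , α) ∷ f) φ ψ = begin
      c ℤ.* (φ α ℤ.+ ψ α) ℤ.+ pair f _
        ≡⟨ cong₂ ℤ._+_ (ℤ.*-distribˡ-+ c (φ α) (ψ α)) (pair-+ f φ ψ) ⟩
      (c ℤ.* φ α ℤ.+ c ℤ.* ψ α) ℤ.+ (pair f φ ℤ.+ pair f ψ)
        ≡⟨ interchange (c ℤ.* φ α) (c ℤ.* ψ α) (pair f φ) (pair f ψ) ⟩
      (c ℤ.* φ α ℤ.+ pair f φ) ℤ.+ (c ℤ.* ψ α ℤ.+ pair f ψ) ∎

    pair-* : ∀ f d φ → pair f (λ α → d ℤ.* φ α) ≡ d ℤ.* pair f φ
    pair-* []            d φ = sym (ℤ.*-zeroʳ d)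
    pair-* ((c , α) ∷ f) d φ = begin
      c ℤ.* (d ℤ.* φ α) ℤ.+ pair f (λ α → d ℤ.* φ α)
        ≡⟨ cong₂ ℤ._+_ (sym (ℤ.*-assoc c d (φ α))) (pair-* f d φ) ⟩
      c ℤ.* d ℤ.* φ α ℤ.+ d ℤ.* pair f φ
        ≡⟨ cong (λ s → s ℤ.* φ α ℤ.+ d ℤ.* pair f φ) (ℤ.*-comm c d) ⟩
      d ℤ.* c ℤ.* φ α ℤ.+ d ℤ.* pair f φ
        ≡⟨ cong (ℤ._+ d ℤ.* pair f φ) (ℤ.*-assoc d c (φ α)) ⟩
      d ℤ.* (c ℤ.* φ α) ℤ.+ d ℤ.* pair f φ
        ≡⟨ sym (ℤ.*-distribˡ-+ d (c ℤ.* φ α) (pair f φ)) ⟩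
      d ℤ.* (c ℤ.* φ α ℤ.+ pair f φ) ∎

    pair-swap : ∀ f g (φ : Monomial N → Monomial N → ℤ) →
                pair f (λ α → pair g (φ α)) ≡ pair g (λ β → pair f (λ α → φ α β))
    pair-swap []            g φ = sym (pair-0 g)
    pair-swap ((c , α) ∷ f) g φ = begin
      c ℤ.* pair g (φ α) ℤ.+ pair f (λ α → pair g (φ α))
        ≡⟨ cong₂ ℤ._+_ (sym (pair-* g c (φ α))) (pair-swap f g φ) ⟩
      pair g (λ β → c ℤ.* φ α β) ℤ.+ pair g (λ β → pair f (λ α → φ α β))
        ≡⟨ sym (pair-+ g _ _) ⟩
      pair g (λ β → c ℤ.* φ α β ℤ.+ pair f (λ α → φ α β)) ∎

    pair-++ : ∀ f g φ → pair (f + g) φ ≡ pair f φ ℤ.+ pair g φ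
    pair-++ []            g φ = sym (ℤ.+-identityˡ _)
    pair-++ ((c , α) ∷ f) g φ =
      trans (cong (λ s → c ℤ.* φ α ℤ.+ s) (pair-++ f g φ)) (sym (ℤ.+-assoc (c ℤ.* φ α) _ _))

    pair-*ₜ : ∀ c α g φ → pair ((c , α) *ₜ g) φ ≡ c ℤ.* pair g (λ β → φ (α ∙ β))
    pair-*ₜ c α []            φ = sym (ℤ.*-zeroʳ c)
    pair-*ₜ c α ((d , β) ∷ g) φ =
      trans (cong₂ ℤ._+_ (ℤ.*-assoc c d _) (pair-*ₜ c α g φ))
            (sym (ℤ.*-distribˡ-+ c _ _))

    pair-** : ∀ f g φ → pair (f * g) φ ≡ pair f (λ α → pair g (λ β → φ (α ∙ β)))
    pair-** []            g φ = refl
    pair-** ((c , α) ∷ f) g φ =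
      trans (pair-++ ((c , α) *ₜ g) (f * g) φ)
            (cong₂ ℤ._+_ (pair-*ₜ c α g φ) (pair-** f g φ))

    pair-neg : ∀ f φ → pair (- f) φ ≡ ℤ.- pair f φ
    pair-neg []            φ = refl
    pair-neg ((c , α) ∷ f) φ =
      trans (cong₂ ℤ._+_ (sym (ℤ.neg-distribˡ-* c (φ α))) (pair-neg f φ))
            (sym (ℤ.neg-distrib-+ (c ℤ.* φ α) (pair f φ)))

    ext : {f g : Poly N} → (∀ φ → pair f φ ≡ pair g φ) → f ≈ g
    ext {f} {g} e = mk≈ λ μ → trans (coeff-pair f μ) (trans (e (δ μ)) (sym (coeff-pair g μ)))

    δ-true : ∀ {μ α} → α ≡ μ → δ μ α ≡ 1ℤ
    δ-true {μ} {α} e rewrite dec-true (α ≟ᵐ μ) e = refl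

    δ-false : ∀ {μ α} → α ≢ μ → δ μ α ≡ 0ℤ
    δ-false {μ} {α} e rewrite dec-false (α ≟ᵐ μ) e = refl

    pair-shift : {f g : Poly N} → f ≈ g → ∀ μ β →
                 pair f (λ α → δ μ (α ∙ β)) ≡ pair g (λ α → δ μ (α ∙ β))
    pair-shift {f} {g} e μ β with ((μ ∸ᵐ β) ∙ β) ≟ᵐ μ
    ... | yes q = begin
      pair f (λ α → δ μ (α ∙ β))   ≡⟨ pair-cong f shift ⟩
      pair f (δ (μ ∸ᵐ β))          ≡⟨ sym (coeff-pair f _) ⟩
      coeff f (μ ∸ᵐ β)             ≡⟨ coeff≡ e _ ⟩
      coeff g (μ ∸ᵐ β)             ≡⟨ coeff-pair g _ ⟩
      pair g (δ (μ ∸ᵐ β))          ≡⟨ sym (pair-cong g shift) ⟩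
      pair g (λ α → δ μ (α ∙ β))   ∎
      where
      shift : ∀ α → δ μ (α ∙ β) ≡ δ (μ ∸ᵐ β) α
      shift α with α ≟ᵐ (μ ∸ᵐ β)
      ... | yes r = δ-true (trans (cong (_∙ β) r) q)
      ... | no ¬r = δ-false λ s → ¬r (trans (sym (∙-∸ α β)) (cong (_∸ᵐ β) s))
    ... | no ¬q = trans (vanish f) (sym (vanish g))
      where
      vanish : ∀ h → pair h (λ α → δ μ (α ∙ β)) ≡ 0ℤ
      vanish h = trans (pair-cong h λ α → δ-false λ s →
        ¬q (trans (cong (_∙ β) (trans (cong (_∸ᵐ β) (sym s)) (∙-∸ α β))) s)) (pair-0 h)

    ≈-refl : {f : Poly N} → f ≈ f
    ≈-refl = mk≈ λ _ → refl

    ≈-sym : {f g : Poly N} → f ≈ g → g ≈ f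
    ≈-sym e = mk≈ λ μ → sym (coeff≡ e μ)

    ≈-trans : {f g h : Poly N} → f ≈ g → g ≈ h → f ≈ h
    ≈-trans d e = mk≈ λ μ → trans (coeff≡ d μ) (coeff≡ e μ)

    coeff-+ : ∀ f g μ → coeff (f + g) μ ≡ coeff f μ ℤ.+ coeff g μ
    coeff-+ f g μ rewrite coeff-pair (f + g) μ | coeff-pair f μ | coeff-pair g μ =
      pair-++ f g (δ μ)

    coeff-neg : ∀ f μ → coeff (- f) μ ≡ ℤ.- coeff f μ
    coeff-neg f μ rewrite coeff-pair (- f) μ | coeff-pair f μ = pair-neg f (δ μ)

    +-cong : {f g h k : Poly N} → f ≈ g → h ≈ k → f + h ≈ g + k
    +-cong {f} {g} {h} {k} d e = mk≈ λ μ → begin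
      coeff (f + h) μ             ≡⟨ coeff-+ f h μ ⟩
      coeff f μ ℤ.+ coeff h μ     ≡⟨ cong₂ ℤ._+_ (coeff≡ d μ) (coeff≡ e μ) ⟩
      coeff g μ ℤ.+ coeff k μ     ≡⟨ sym (coeff-+ g k μ) ⟩
      coeff (g + k) μ             ∎

    neg-cong : {f g : Poly N} → f ≈ g → - f ≈ - g
    neg-cong {f} {g} e = mk≈ λ μ →
      trans (coeff-neg f μ) (trans (cong ℤ.-_ (coeff≡ e μ)) (sym (coeff-neg g μ)))

    +-assoc : (f g h : Poly N) → (f + g) + h ≈ f + (g + h)
    +-assoc f g h = ext λ φ → begin
      pair ((f + g) + h) φ                        ≡⟨ pair-++ (f + g) h φ ⟩
      pair (f + g) φ ℤ.+ pair h φ                 ≡⟨ cong (ℤ._+ pair h φ) (pair-++ f g φ) ⟩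
      pair f φ ℤ.+ pair g φ ℤ.+ pair h φ          ≡⟨ ℤ.+-assoc (pair f φ) _ _ ⟩
      pair f φ ℤ.+ (pair g φ ℤ.+ pair h φ)        ≡⟨ cong (λ s → pair f φ ℤ.+ s) (sym (pair-++ g h φ)) ⟩
      pair f φ ℤ.+ pair (g + h) φ                 ≡⟨ sym (pair-++ f (g + h) φ) ⟩
      pair (f + (g + h)) φ                        ∎

    +-comm : (f g : Poly N) → f + g ≈ g + f
    +-comm f g = ext λ φ →
      trans (pair-++ f g φ) (trans (ℤ.+-comm (pair f φ) _) (sym (pair-++ g f φ)))

    +-identityˡ : (f : Poly N) → 0# + f ≈ f
    +-identityˡ f = ≈-refl

    neg-inverseˡ : ∀ f → - f + f ≈ 0#
    neg-inverseˡ f = ext λ φ →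
      trans (pair-++ (- f) f φ)
            (trans (cong (ℤ._+ pair f φ) (pair-neg f φ)) (ℤ.+-inverseˡ (pair f φ)))

    *-comm : (f g : Poly N) → f * g ≈ g * f
    *-comm f g = ext λ φ → begin
      pair (f * g) φ                                  ≡⟨ pair-** f g φ ⟩
      pair f (λ α → pair g (λ β → φ (α ∙ β)))         ≡⟨ pair-swap f g _ ⟩
      pair g (λ β → pair f (λ α → φ (α ∙ β)))
        ≡⟨ pair-cong g (λ β → pair-cong f λ α → cong φ (∙-comm α β)) ⟩
      pair g (λ β → pair f (λ α → φ (β ∙ α)))         ≡⟨ sym (pair-** g f φ) ⟩
      pair (g * f) φ                                  ∎

    *-congʳ : {f g : Poly N} (h : Poly N) → f ≈ g → f * h ≈ g * h
    *-congʳ {f} {g} h e = mk≈ λ μ →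
      trans (swap f μ) (trans (pair-cong h (pair-shift e μ)) (sym (swap g μ)))
      where
      swap : ∀ k μ → coeff (k * h) μ ≡ pair h (λ β → pair k (λ α → δ μ (α ∙ β)))
      swap k μ = trans (coeff-pair (k * h) μ) (trans (pair-** k h (δ μ)) (pair-swap k h _))

    *-cong : {f g h k : Poly N} → f ≈ g → h ≈ k → f * h ≈ g * k
    *-cong {f} {g} {h} {k} d e =
      ≈-trans (*-congʳ h d) (≈-trans (*-comm g h) (≈-trans (*-congʳ g e) (*-comm k g)))

    *-assoc : (f g h : Poly N) → (f * g) * h ≈ f * (g * h)
    *-assoc f g h = ext λ φ → begin
      pair ((f * g) * h) φ
        ≡⟨ pair-** (f * g) h φ ⟩
      pair (f * g) (λ α → pair h (λ γ → φ (α ∙ γ)))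
        ≡⟨ pair-** f g _ ⟩
      pair f (λ α → pair g (λ β → pair h (λ γ → φ ((α ∙ β) ∙ γ))))
        ≡⟨ pair-cong f (λ α → pair-cong g λ β → pair-cong h λ γ → cong φ (∙-assoc α β γ)) ⟩
      pair f (λ α → pair g (λ β → pair h (λ γ → φ (α ∙ (β ∙ γ)))))
        ≡⟨ pair-cong f (λ α → sym (pair-** g h _)) ⟩
      pair f (λ α → pair (g * h) (λ β → φ (α ∙ β)))
        ≡⟨ sym (pair-** f (g * h) φ) ⟩
      pair (f * (g * h)) φ ∎

    *-identityˡ : ∀ f → 1# * f ≈ f
    *-identityˡ f = ext λ φ → begin
      pair (1# * f) φ                                   ≡⟨ pair-** 1# f φ ⟩
      1ℤ ℤ.* pair f (λ β → φ (replicate N 0 ∙ β)) ℤ.+ 0ℤ ≡⟨ ℤ.+-identityʳ _ ⟩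
      1ℤ ℤ.* pair f (λ β → φ (replicate N 0 ∙ β))       ≡⟨ ℤ.*-identityˡ _ ⟩
      pair f (λ β → φ (replicate N 0 ∙ β))
        ≡⟨ pair-cong f (λ β → cong φ (∙-identityˡ β)) ⟩
      pair f φ ∎

    *-distribʳ : (f g h : Poly N) → (g + h) * f ≈ g * f + h * f
    *-distribʳ f g h = ext λ φ → begin
      pair ((g + h) * f) φ                   ≡⟨ pair-** (g + h) f φ ⟩
      pair (g + h) _                         ≡⟨ pair-++ g h _ ⟩
      pair g _ ℤ.+ pair h _                  ≡⟨ sym (cong₂ ℤ._+_ (pair-** g f φ) (pair-** h f φ)) ⟩
      pair (g * f) φ ℤ.+ pair (h * f) φ      ≡⟨ sym (pair-++ (g * f) (h * f) φ) ⟩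
      pair (g * f + h * f) φ                 ∎

    isCommutativeRing : IsCommutativeRing (_≈_ {N}) _+_ _*_ -_ 0# 1#
    isCommutativeRing = record
      { isRing = record
        { +-isAbelianGroup = record
          { isGroup = record
            { isMonoid = record
              { isSemigroup = record
                { isMagma = record
                  { isEquivalence = record { refl = ≈-refl ; sym = ≈-sym ; trans = ≈-trans }
                  ; ∙-cong = +-cong
                  }
                ; assoc = +-assoc
                }
              ; identity = +-identityˡ , λ f → ≈-trans (+-comm f 0#) (+-identityˡ f)
              }
            ; inverse = neg-inverseˡ , λ f → ≈-trans (+-comm f (- f)) (neg-inverseˡ f)
            ; ⁻¹-cong = neg-cong
            }
          ; comm = +-comm
          }
        ; *-cong = *-cong
        ; *-assoc = *-assoc
        ; *-identity = *-identityˡ , λ f → ≈-trans (*-comm f 1#) (*-identityˡ f)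
        ; distrib = (λ f g h → ≈-trans (*-comm f (g + h))
                       (≈-trans (*-distribʳ f g h) (+-cong (*-comm g f) (*-comm h f))))
                  , *-distribʳ
        }
      ; *-comm = *-comm
      }

ℤ[X]_ : ℕ → CommutativeRing _ _
ℤ[X] N = record { isCommutativeRing = Laws.isCommutativeRing {N} }

module RingTheory (R : CommutativeRing a ℓ) where
  private module R = CommutativeRing R
  open R using (Carrier)
  open import Algebra.Properties.Semiring.Sum R.semiring using (sum)
  open import Algebra.Properties.Semiring.Exp R.semiring using (_^_)

  -- The least ideal containing S.
  data Generated (S : Pred Carrier p) : Pred Carrier (a ⊔ ℓ ⊔ p) where
    gen  : ∀ {f} → S f → Generated S f
    zero : Generated S R.0#
    add  : ∀ {f g} → Generated S f → Generated S g → Generated S (f R.+ g)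
    mul  : ∀ f {g} → Generated S g → Generated S (f R.* g)
    resp : ∀ {f g} → f R.≈ g → Generated S f → Generated S g

  ⟨_⟩ : List Carrier → Pred Carrier (a ⊔ ℓ)
  ⟨ fs ⟩ = Generated (_∈ fs)

  Matrix : ℕ → ℕ → Set a
  Matrix m n = Fin m → Fin n → Carrier

  -- Laplace expansion along the first row.
  det : ∀ {k} → Matrix k k → Carrier
  det {zero}  A = R.1#
  det {suc k} A = sum λ j →
    (R.- R.1#) ^ toℕ j R.* A zero j R.* det (λ i l → A (suc i) (punchIn j l))

  StrictlyIncreasing : ∀ {k n} → (Fin k → Fin n) → Set
  StrictlyIncreasing = Monotonic₁ Fin._<_ Fin._<_

  -- The increasing maps r and c select the rows and columns of the submatrix.
  IsMinor : ∀ {m n} (k : ℕ) → Matrix m n → Pred Carrier ℓ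
  IsMinor k A f = ∃₂ λ r c →
    StrictlyIncreasing {k} r × StrictlyIncreasing {k} c × f R.≈ det (λ i j → A (r i) (c j))

-- Finite loopless multigraphs on the vertex set Fin order; mult u v is the
-- number of edges between u and v.
record Graph : Set where
  field
    order    : ℕ
    mult     : Fin order → Fin order → ℕ
    mult-sym : ∀ u v → mult u v ≡ mult v u
    loopless : ∀ u → mult u u ≡ 0

Connected : Graph → Set
Connected G = ∀ u v → Star (λ s t → mult s t ≢ 0) u v
  where open Graph G

module _ (G : Graph) where
  open Graph G
  open RingTheory (ℤ[X] order)

  generalizedLaplacian : Matrix order order
  generalizedLaplacian u v =
    if does (u Fin.≟ v) then X u else con (ℤ.- (ℤ.+ mult u v))

  criticalIdeal : ℕ → Pred (Poly order) _
  criticalIdeal k = Generated (IsMinor k generalizedLaplacian)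

module Tripartite (m n o : ℕ) where

  -- The first m vertices form the first part, the next n the second, the last
  -- o the third.
  part : Fin (m ℕ.+ n ℕ.+ o) → Fin 3
  part u = [ (λ v → [ const 0F , const 1F ]′ (splitAt m v)) , const 2F ]′ (splitAt (m ℕ.+ n) u)

  K : Graph
  K = record
    { order    = m ℕ.+ n ℕ.+ o
    ; mult     = λ u v → adj (part u) (part v)
    ; mult-sym = λ u v → adj-sym (part u) (part v)
    ; loopless = λ u → adj-irrefl (part u)
    }
    where
    adj : Fin 3 → Fin 3 → ℕ
    adj s t = if does (s Fin.≟ t) then 0 else 1

    adj-irrefl : ∀ s → adj s s ≡ 0
    adj-irrefl s rewrite dec-true (s Fin.≟ s) refl = refl

    adj-sym : ∀ s t → adj s t ≡ adj t s
    adj-sym s t with s Fin.≟ t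
    ... | yes refl = sym (adj-irrefl s)
    ... | no  s≢t rewrite dec-false (t Fin.≟ s) (s≢t ∘ sym) = refl

  x : Fin m → Poly (m ℕ.+ n ℕ.+ o)
  x i = X (i ↑ˡ n ↑ˡ o)

  y : Fin n → Poly (m ℕ.+ n ℕ.+ o)
  y j = X ((m ↑ʳ j) ↑ˡ o)

  z : Fin o → Poly (m ℕ.+ n ℕ.+ o)
  z k = X ((m ℕ.+ n) ↑ʳ k)

  xs ys zs : List (Poly (m ℕ.+ n ℕ.+ o))
  xs = tabulate x
  ys = tabulate y
  zs = tabulate z

  I₃ : Pred (Poly (m ℕ.+ n ℕ.+ o)) _
  I₃ = criticalIdeal K 3

  open RingTheory (ℤ[X] (m ℕ.+ n ℕ.+ o)) public using (⟨_⟩)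

  Admissible : Set
  Admissible =
    m ℕ.≥ n × n ℕ.≥ o × o ℕ.≥ 0 × m ℕ.+ n ℕ.+ o ℕ.≥ 4 × Connected K

{-# OPTIONS --safe #-}
module Submission where

open import Defs using (module RingTheory)
open import Algebra.Bundles using (CommutativeRing)
import Algebra.Solver.Ring as RingSolver
open import Algebra.Solver.Ring.AlmostCommutativeRing
  using (_-Raw-AlmostCommutative⟶_; fromCommutativeRing)
open import Data.Bool.Base using (true; false; if_then_else_)
open import Data.Fin.Base as Fin using (Fin; suc; _↑ˡ_; _↑ʳ_)
import Data.Fin.Properties as Fin
open import Data.Fin.Patterns using (0F; 1F; 2F; 3F)
open import Data.Integer.Base as ℤ using (ℤ; +_; 0ℤ; 1ℤ; -1ℤ)
import Data.Integer.Properties as ℤ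
open import Data.List.Base using (List; _∷_; []; _++_; [_])
open import Data.List.Membership.Propositional using (_∈_)
open import Data.List.Membership.Propositional.Properties using (∈-++⁺ˡ; ∈-++⁺ʳ; ∈-tabulate⁺)
open import Data.List.Relation.Unary.All as ListAll using (_∷_; [])
import Data.List.Relation.Unary.All.Properties as ListAll
open import Data.List.Relation.Unary.Any using (here; there)
import Data.Maybe.Base as Maybe
open import Data.Nat.Base as ℕ using (ℕ; suc; _≥_; z≤n; s≤s)
import Data.Nat.Properties as ℕ
open import Data.Product.Base using (_×_; _,_; ∃₂)
open import Data.Sum.Base using (inj₁; inj₂)
open import Data.Vec.Base as Vec using (Vec; _∷_; []; lookup)
import Data.Vec.Properties as Vec
open import Data.Vec.Relation.Unary.All using (All; _∷_; [])
open import Function.Base using (_∘_; case_of_)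
open import Relation.Binary.Definitions using (tri<; tri≈; tri>)
open import Relation.Binary.PropositionalEquality as ≡ using (_≡_; _≢_)
open import Relation.Nullary using (does; yes; no)
open import Relation.Nullary.Decidable using (dec⇒maybe; dec-true; dec-false)
open import Relation.Unary using (Pred; _⊆_; _≐_)

-- Modulo the claimed ideal J, the Laplacian is a 3×3 matrix C blown up along a
-- map from the vertices to three classes: a class either consists of vertices
-- whose indeterminates lie in J, or is a single vertex. Hence every 3×3 minor
-- repeats a row or column modulo J, or is ± det C, which lies in J. Conversely,
-- each generator of J is a combination of a few minors. Only for K₂,₁,₁ and K₂,₂
-- there are no such classes; there all sixteen minors are expanded.

-- The reverse inclusion turns on one choice. Inside a part with at least two vertices, taking
-- different vertices for the row and the column puts 0 where equal ones would put an indeterminate,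
-- while entries between parts stay -1; comparing two such minors isolates an indeterminate. A part
-- with at least three vertices yields its indeterminates directly, from minors with one further
-- vertex outside it. For K₂,₁,₁ and K₂,₂ neither method can work: their ideals contain no single
-- indeterminate, so a part of size two cannot be collapsed. The obstacle is order. Minors are
-- defined by increasing index maps, but neither these choices nor the map to classes respects the
-- order of the vertices. Ideals do not see signs, so membership of minors is extended to arbitrary
-- triples of rows and columns.

module _ {p} {N : ℕ} (P : Fin N → Fin N → Fin N → Set p)
  (swap₁₂ : ∀ {a b c} → P a b c → P b a c)
  (swap₂₃ : ∀ {a b c} → P a b c → P a c b)
  (repeated : ∀ {a c} → P a a c)
  (increasing : ∀ {a b c} → a Fin.< b → b Fin.< c → P a b c) where

  private
    sort : ∀ {a b} c → a Fin.< b → P a b c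
    sort {a} {b} c a<b with Fin.<-cmp b c
    ... | tri< b<c _ _ = increasing a<b b<c
    ... | tri≈ _ ≡.refl _ = swap₁₂ (swap₂₃ repeated)
    ... | tri> _ _ c<b with Fin.<-cmp a c
    ...   | tri< a<c _ _ = swap₂₃ (increasing a<c c<b)
    ...   | tri≈ _ ≡.refl _ = swap₂₃ repeated
    ...   | tri> _ _ c<a = swap₂₃ (swap₁₂ (increasing c<a a<b))

  -- Adjacent transpositions sort any triple. With distinct indices the sorted triple is increasing;
  -- otherwise two equal indices can be moved to the front, where `repeated` applies.
  alternating-induction : ∀ a b c → P a b c
  alternating-induction a b c with Fin.<-cmp a b
  ... | tri< a<b _ _ = sort c a<b
  ... | tri≈ _ ≡.refl _ = repeated
  ... | tri> _ _ b<a = swap₁₂ (sort c b<a)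

-- 3×3 minors over a commutative ring

module Determinants {a ℓ} (R : CommutativeRing a ℓ)
  (morphism : ℤ.+-*-rawRing -Raw-AlmostCommutative⟶ fromCommutativeRing R) where

  open CommutativeRing R hiding (zero)
  open import Algebra.Properties.Ring ring using (-1*x≈-x; -‿involutive)
  open import Relation.Binary.Reasoning.Setoid setoid
  open RingTheory R
  open _-Raw-AlmostCommutative⟶_ morphism renaming (⟦_⟧ to ι)
  open RingSolver ℤ.+-*-rawRing (fromCommutativeRing R) morphism
    (λ c d → Maybe.map (λ e → reflexive (≡.cong ι e)) (dec⇒maybe (c ℤ.≟ d)))
    renaming (con to :con) public

  det₃ : (a b c d e f g h i : Carrier) → Carrier
  det₃ a b c d e f g h i =
    a * (e * i - f * h) - b * (d * i - f * g) + c * (d * h - e * g)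

  :det₃ : ∀ {k} (a b c d e f g h i : Polynomial k) → Polynomial k
  :det₃ a b c d e f g h i =
    a :* (e :* i :- f :* h) :- b :* (d :* i :- f :* g) :+ c :* (d :* h :- e :* g)

  minor₃ : ∀ {m n} → Matrix m n → (a b c : Fin m) (u v w : Fin n) → Carrier
  minor₃ A a b c u v w =
    det₃ (A a u) (A a v) (A a w) (A b u) (A b v) (A b w) (A c u) (A c v) (A c w)

  private
    -- These three lemmas clear the Laplace signs `(- 1#) ^ j` for j = 0, 1, 2, in the unfolded form
    -- that `det` produces.
    plus : ∀ x d → 1# * x * d ≈ x * d
    plus x d = *-congʳ (*-identityˡ x)

    minus : ∀ x d → (- 1# * 1#) * x * d ≈ - (x * d)
    minus x d = begin
      (- 1# * 1#) * x * d  ≈⟨ *-congʳ (*-congʳ (*-identityʳ _)) ⟩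
      - 1# * x * d         ≈⟨ *-assoc _ x d ⟩
      - 1# * (x * d)       ≈⟨ -1*x≈-x _ ⟩
      - (x * d)            ∎

    plus′ : ∀ x d → (- 1# * (- 1# * 1#)) * x * d ≈ x * d
    plus′ x d = *-congʳ (trans (*-congʳ (begin
      - 1# * (- 1# * 1#)  ≈⟨ -1*x≈-x _ ⟩
      - (- 1# * 1#)       ≈⟨ -‿cong (*-identityʳ _) ⟩
      - (- 1#)            ≈⟨ -‿involutive 1# ⟩
      1#                  ∎)) (*-identityˡ x))

    det₁ : (A : Matrix 1 1) → det A ≈ A 0F 0F
    det₁ A = trans (+-identityʳ _) (trans (*-identityʳ _) (*-identityˡ _))

    det₂ : (A : Matrix 2 2) → det A ≈ A 0F 0F * A 1F 1F - A 0F 1F * A 1F 0F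
    det₂ A = +-cong
      (trans (plus _ _) (*-congˡ (det₁ λ _ _ → A 1F 1F)))
      (trans (+-identityʳ _) (trans (minus _ _) (-‿cong (*-congˡ (det₁ λ _ _ → A 1F 0F)))))

  det≈det₃ : (A : Matrix 3 3) → det A ≈ minor₃ A 0F 1F 2F 0F 1F 2F
  det≈det₃ A = trans (sym (+-assoc _ _ _)) (+-cong
    (+-cong (trans (plus _ _) (*-congˡ (det₂ (delete 0F))))
            (trans (minus _ _) (-‿cong (*-congˡ (det₂ (delete 1F))))))
    (trans (+-identityʳ _) (trans (plus′ _ _) (*-congˡ (det₂ (delete 2F))))))
    where
    delete : Fin 3 → Matrix 2 2
    delete j i l = A (suc i) (Fin.punchIn j l)

  det₃-transpose : ∀ a b c d e f g h i → det₃ a b c d e f g h i ≈ det₃ a d g b e h c f i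
  det₃-transpose = solve 9 (λ a b c d e f g h i →
    :det₃ a b c d e f g h i := :det₃ a d g b e h c f i) refl

  det₃-swap₁₂ : ∀ a b c d e f g h i → - det₃ a b c d e f g h i ≈ det₃ d e f a b c g h i
  det₃-swap₁₂ = solve 9 (λ a b c d e f g h i →
    :- :det₃ a b c d e f g h i := :det₃ d e f a b c g h i) refl

  det₃-swap₂₃ : ∀ a b c d e f g h i → - det₃ a b c d e f g h i ≈ det₃ a b c g h i d e f
  det₃-swap₂₃ = solve 9 (λ a b c d e f g h i →
    :- :det₃ a b c d e f g h i := :det₃ a b c g h i d e f) refl

  det₃-repeated : ∀ a b c g h i → ι 0ℤ ≈ det₃ a b c a b c g h i
  det₃-repeated = solve 6 (λ a b c g h i →
    :con 0ℤ := :det₃ a b c a b c g h i) refl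

  -- Congruence modulo an ideal

  module _ {ℓ′} {S : Pred Carrier ℓ′} where

    private
      J : Pred Carrier _
      J = Generated S

    infix 4 _~_
    _~_ : Carrier → Carrier → Set _
    f ~ g = J (f - g)

    neg : ∀ {f} → J f → J (- f)
    neg Jf = resp (-1*x≈-x _) (mul _ Jf)

    sub : ∀ {f g} → J f → J g → J (f - g)
    sub Jf Jg = add Jf (neg Jg)

    ~-refl : ∀ f → f ~ f
    ~-refl f = resp (sym (-‿inverseʳ f)) zero

    ≡⇒~ : ∀ {f g} → f ≡ g → f ~ g
    ≡⇒~ ≡.refl = ~-refl _

    -- Zeros written by the solver have the form `ι 0ℤ`, which agrees with `0#` only up to `≈`.
    ι0∈ : J (ι 0ℤ)
    ι0∈ = resp (sym 0-homo) zero

    ~-respects : ∀ {f g} → f ~ g → J g → J f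
    ~-respects {f} {g} f~g Jg =
      resp (solve 2 (λ f g → f :- g :+ g := f) refl f g) (add f~g Jg)

    ⊕-~ : ∀ {f g h k} → f ~ g → h ~ k → f + h ~ g + k
    ⊕-~ {f} {g} {h} {k} d e = resp
      (solve 4 (λ f g h k → f :- g :+ (h :- k) := f :+ h :- (g :+ k)) refl f g h k)
      (add d e)

    ⊖-~ : ∀ {f g h k} → f ~ g → h ~ k → f - h ~ g - k
    ⊖-~ {f} {g} {h} {k} d e = resp
      (solve 4 (λ f g h k → f :- g :- (h :- k) := f :- h :- (g :- k)) refl f g h k)
      (sub d e)

    ⊛-~ : ∀ {f g h k} → f ~ g → h ~ k → f * h ~ g * k
    ⊛-~ {f} {g} {h} {k} d e = resp
      (solve 4 (λ f g h k → h :* (f :- g) :+ g :* (h :- k) := f :* h :- g :* k) refl f g h k)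
      (add (mul h d) (mul g e))

    -- A minor is a polynomial in its entries, so it respects congruence. The maps `ρ` and `σ` need
    -- not be injective, which is what allows a large Laplacian to be compared with a 3×3 matrix.
    minor₃-~ : ∀ {k l m n} {A : Matrix k l} {B : Matrix m n}
      {ρ : Fin k → Fin m} {σ : Fin l → Fin n} →
      (∀ i j → A i j ~ B (ρ i) (σ j)) → ∀ a b c u v w →
      minor₃ A a b c u v w ~ minor₃ B (ρ a) (ρ b) (ρ c) (σ u) (σ v) (σ w)
    minor₃-~ e a b c u v w = ⊕-~
      (⊖-~ (⊛-~ (e a u) (⊖-~ (⊛-~ (e b v) (e c w)) (⊛-~ (e b w) (e c v))))
           (⊛-~ (e a v) (⊖-~ (⊛-~ (e b u) (e c w)) (⊛-~ (e b w) (e c u)))))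
      (⊛-~ (e a w) (⊖-~ (⊛-~ (e b u) (e c v)) (⊛-~ (e b v) (e c u))))

    IncreasingMinors∈ : ∀ {m n} → Matrix m n → Set _
    IncreasingMinors∈ A = ∀ {a b c u v w} →
      a Fin.< b → b Fin.< c → u Fin.< v → v Fin.< w → J (minor₃ A a b c u v w)

    increasing⇒all-minors : ∀ {m n} (A : Matrix m n) → IncreasingMinors∈ A →
      ∀ a b c u v w → J (minor₃ A a b c u v w)
    increasing⇒all-minors A inc = alternating-induction
      (λ a b c → ∀ u v w → J (minor₃ A a b c u v w))
      (λ h u v w → resp (det₃-swap₁₂ _ _ _ _ _ _ _ _ _) (neg (h u v w)))
      (λ h u v w → resp (det₃-swap₂₃ _ _ _ _ _ _ _ _ _) (neg (h u v w)))
      (λ u v w → resp (det₃-repeated _ _ _ _ _ _) ι0∈)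
      -- For fixed increasing rows, the same induction runs over the columns; transposition turns
      -- each column operation into a row operation.
      λ a<b b<c → alternating-induction _
        (λ h → transpose (resp (det₃-swap₁₂ _ _ _ _ _ _ _ _ _) (neg (transpose h))))
        (λ h → transpose (resp (det₃-swap₂₃ _ _ _ _ _ _ _ _ _) (neg (transpose h))))
        (transpose (resp (det₃-repeated _ _ _ _ _ _) ι0∈))
        (inc a<b b<c)
      where
      transpose : ∀ {a b c d e f g h i} → J (det₃ a b c d e f g h i) → J (det₃ a d g b e h c f i)
      transpose = resp (det₃-transpose _ _ _ _ _ _ _ _ _)

    -- `0F 1F 2F` is the only increasing triple in `Fin 3`; any other choice of indices permutes it
    -- or repeats an index.
    minors₃-of-3×3 : (A : Matrix 3 3) → J (minor₃ A 0F 1F 2F 0F 1F 2F) →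
      ∀ a b c u v w → J (minor₃ A a b c u v w)
    minors₃-of-3×3 A d = increasing⇒all-minors A inc
      where
      is-012 : ∀ {a b c : Fin 3} → a Fin.< b → b Fin.< c → a ≡ 0F × b ≡ 1F × c ≡ 2F
      is-012 {0F} {1F} {2F} _ _ = ≡.refl , ≡.refl , ≡.refl
      is-012 {_} {2F} {1F} _ (s≤s ())
      is-012 {_} {2F} {2F} _ (s≤s (s≤s ()))
      is-012 {_} {1F} {1F} _ (s≤s ())
      is-012 {1F} {1F} (s≤s ()) _
      is-012 {2F} {1F} (s≤s ()) _

      inc : IncreasingMinors∈ A
      inc a<b b<c u<v v<w with is-012 a<b b<c | is-012 u<v v<w
      ... | ≡.refl , ≡.refl , ≡.refl | ≡.refl , ≡.refl , ≡.refl = d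

    Generated-minimal : ∀ {q} {T : Pred Carrier q} → T ⊆ J → Generated T ⊆ J
    Generated-minimal T⊆J (gen t)   = T⊆J t
    Generated-minimal T⊆J zero      = zero
    Generated-minimal T⊆J (add f g) = add (Generated-minimal T⊆J f) (Generated-minimal T⊆J g)
    Generated-minimal T⊆J (mul f g) = mul f (Generated-minimal T⊆J g)
    Generated-minimal T⊆J (resp e f) = resp e (Generated-minimal T⊆J f)

    minors⊆ : ∀ {m n} {A : Matrix m n} → IncreasingMinors∈ A → Generated (IsMinor 3 A) ⊆ J
    minors⊆ {A = A} inc = Generated-minimal λ (r , c , r↑ , c↑ , f≈det) →
      resp (sym (trans f≈det (det≈det₃ (λ i j → A (r i) (c j)))))
        (inc (r↑ {0F} {1F} (s≤s z≤n)) (r↑ {1F} {2F} (s≤s (s≤s z≤n)))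
             (c↑ {0F} {1F} (s≤s z≤n)) (c↑ {1F} {2F} (s≤s (s≤s z≤n))))

    minors-≡⊆ : ∀ {m n} {A B : Matrix m n} → (∀ i j → A i j ≡ B i j) →
      IncreasingMinors∈ B → Generated (IsMinor 3 A) ⊆ J
    minors-≡⊆ A≡B inc = minors⊆ λ a<b b<c u<v v<w →
      ~-respects (minor₃-~ {ρ = λ i → i} {σ = λ j → j} (λ i j → ≡⇒~ (A≡B i j)) _ _ _ _ _ _)
        (inc a<b b<c u<v v<w)

    minors-factor⊆ : ∀ {m n} {A : Matrix m n} (C : Matrix 3 3)
      (ρ : Fin m → Fin 3) (σ : Fin n → Fin 3) →
      (∀ i j → A i j ~ C (ρ i) (σ j)) → J (minor₃ C 0F 1F 2F 0F 1F 2F) →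
      Generated (IsMinor 3 A) ⊆ J
    minors-factor⊆ C ρ σ A~C d = minors⊆ λ {a} {b} {c} {u} {v} {w} _ _ _ _ →
      ~-respects (minor₃-~ {B = C} A~C a b c u v w)
        (minors₃-of-3×3 C d (ρ a) (ρ b) (ρ c) (σ u) (σ v) (σ w))

  minor₃∈ : ∀ {m n} (A : Matrix m n) a b c u v w → Generated (IsMinor 3 A) (minor₃ A a b c u v w)
  minor₃∈ A = increasing⇒all-minors A λ {a} {b} {c} {u} {v} {w} a<b b<c u<v v<w →
    resp (det≈det₃ (λ i j → A (triple a b c i) (triple u v w j)))
      (gen (triple a b c , triple u v w ,
        triple-increasing a<b b<c , triple-increasing u<v v<w , refl))
    where
    triple : ∀ {n} → Fin n → Fin n → Fin n → Fin 3 → Fin n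
    triple a b c 0F = a
    triple a b c 1F = b
    triple a b c 2F = c

    triple-increasing : ∀ {n} {a b c : Fin n} → a Fin.< b → b Fin.< c →
      StrictlyIncreasing (triple a b c)
    triple-increasing a<b b<c {0F} {1F} _ = a<b
    triple-increasing a<b b<c {0F} {2F} _ = Fin.<-trans a<b b<c
    triple-increasing a<b b<c {1F} {2F} _ = b<c
    triple-increasing a<b b<c {0F} {0F} ()
    triple-increasing a<b b<c {1F} {0F} ()
    triple-increasing a<b b<c {1F} {1F} (s≤s ())
    triple-increasing a<b b<c {2F} {0F} ()
    triple-increasing a<b b<c {2F} {1F} (s≤s ())
    triple-increasing a<b b<c {2F} {2F} (s≤s (s≤s ()))

  -- Explicit determinants and certificates of membership

  :0 :1 :2 :-1 : ∀ {k} → Polynomial k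
  :0  = :con 0ℤ
  :1  = :con 1ℤ
  :2  = :con (+ 2)
  :-1 = :con -1ℤ

  -- A membership certificate kept syntactic, so that the solver can compare it with a minor.
  :combination : ∀ {k n} → Vec (Polynomial k) n → Vec (Polynomial k) n → Polynomial k
  :combination []       []       = :con 0ℤ
  :combination (c ∷ cs) (g ∷ gs) = c :* g :+ :combination cs gs

  -- det C when the three classes are the three parts.
  τ : Carrier → Carrier → Carrier → Carrier
  τ p q r = det₃ p (ι -1ℤ) (ι -1ℤ) (ι -1ℤ) q (ι -1ℤ) (ι -1ℤ) (ι -1ℤ) r

  :τ : ∀ {k} → Polynomial k → Polynomial k → Polynomial k → Polynomial k
  :τ p q r = :det₃ p :-1 :-1 :-1 q :-1 :-1 :-1 r

  module _ {ℓ′} {S : Pred Carrier ℓ′} where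

    private
      J : Pred Carrier _
      J = Generated S

    combination∈ : ∀ {k n} {ρ : Vec Carrier k} {gs : Vec (Polynomial k) n} →
      All (λ g → J (⟦ g ⟧ ρ)) gs → ∀ cs → J (⟦ :combination cs gs ⟧ ρ)
    combination∈ []          []       = ι0∈
    combination∈ (Jg ∷ Jgs)  (c ∷ cs) = add (mul _ Jg) (combination∈ Jgs cs)

    -- Expanded, `τ p q r` is pqr - p - q - r - 2; this is the origin of the constant 2 in the
    -- claimed generators.
    2⇒τ000 : J (ι (+ 2)) → J (τ (ι 0ℤ) (ι 0ℤ) (ι 0ℤ))
    2⇒τ000 J2 = resp (solve 0 (:- :2 := :τ :0 :0 :0) refl) (neg J2)

    τ000⇒2 : J (τ (ι 0ℤ) (ι 0ℤ) (ι 0ℤ)) → J (ι (+ 2))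
    τ000⇒2 d = resp (solve 0 (:- :τ :0 :0 :0 := :2) refl) (neg d)

    r+2⇒τ00r : ∀ r → J (r + ι (+ 2)) → J (τ (ι 0ℤ) (ι 0ℤ) r)
    r+2⇒τ00r r h = resp (solve 1 (λ r → :- (r :+ :2) := :τ :0 :0 r) refl r) (neg h)

    τ00r⇒r+2 : ∀ r → J (τ (ι 0ℤ) (ι 0ℤ) r) → J (r + ι (+ 2))
    τ00r⇒r+2 r d = resp (solve 1 (λ r → :- :τ :0 :0 r := r :+ :2) refl r) (neg d)

    q+r+2⇒τ0qr : ∀ q r → J (q + r + ι (+ 2)) → J (τ (ι 0ℤ) q r)
    q+r+2⇒τ0qr q r h = resp (solve 2 (λ q r → :- (q :+ r :+ :2) := :τ :0 q r) refl q r) (neg h)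

    τ0qr⇒q+r+2 : ∀ q r → J (τ (ι 0ℤ) q r) → J (q + r + ι (+ 2))
    τ0qr⇒q+r+2 q r d = resp (solve 2 (λ q r → :- :τ :0 q r := q :+ r :+ :2) refl q r) (neg d)

    -- With o = 0 the third class is empty, so its diagonal entry is free and can
    -- be chosen to make the determinant vanish.
    τ-degenerate : ∀ q → J (τ (ι 0ℤ) q (- q - ι (+ 2)))
    τ-degenerate q = resp (solve 1 (λ q → :0 := :τ :0 q (:- q :- :2)) refl q) ι0∈

    -- Once one argument of `τ` is 0, the cubic term is gone and each other argument enters with
    -- coefficient -1, so a difference of two values isolates the argument that changed.
    τp0r⇒p : ∀ p r → J (τ (ι 0ℤ) (ι 0ℤ) r) → J (τ p (ι 0ℤ) r) → J p
    τp0r⇒p p r d e = resp (solve 2 (λ p r → :τ :0 :0 r :- :τ p :0 r := p) refl p r) (sub d e)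

    τ0qr⇒q : ∀ q r → J (τ (ι 0ℤ) (ι 0ℤ) r) → J (τ (ι 0ℤ) q r) → J q
    τ0qr⇒q q r d e = resp (solve 2 (λ q r → :τ :0 :0 r :- :τ :0 q r := q) refl q r) (sub d e)

    τ00r⇒r : ∀ r → J (τ (ι 0ℤ) (ι 0ℤ) (ι 0ℤ)) → J (τ (ι 0ℤ) (ι 0ℤ) r) → J r
    τ00r⇒r r d e = resp (solve 1 (λ r → :τ :0 :0 :0 :- :τ :0 :0 r := r) refl r) (sub d e)

    τ∈ : ∀ {p q r a b c d e f g h i} → a ≡ p → e ≡ q → i ≡ r → b ≡ ι -1ℤ → c ≡ ι -1ℤ → d ≡ ι -1ℤ →
      f ≡ ι -1ℤ → g ≡ ι -1ℤ → h ≡ ι -1ℤ → J (det₃ a b c d e f g h i) → J (τ p q r)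
    τ∈ ≡.refl ≡.refl ≡.refl ≡.refl ≡.refl ≡.refl ≡.refl ≡.refl ≡.refl d = d

    -- The cofactor of the corner `i` is p·e - b·d, which is 0 here. Hence one outside vertex can
    -- serve as both the third row and the third column.
    triple⇒p : ∀ {p b d e c f g h i} → b ≡ ι 0ℤ → d ≡ ι 0ℤ → e ≡ ι 0ℤ →
      c ≡ ι -1ℤ → f ≡ ι -1ℤ → g ≡ ι -1ℤ → h ≡ ι -1ℤ → J (det₃ p b c d e f g h i) → J p
    triple⇒p {p} {i = i} ≡.refl ≡.refl ≡.refl ≡.refl ≡.refl ≡.refl ≡.refl m = resp
      (solve 2 (λ p i → :- :det₃ p :0 :-1 :0 :0 :-1 :-1 :-1 i := p) refl p i) (neg m)

    -- Here the cofactor of the corner `i` is p·q, so the corner must itself be 0: the third row and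
    -- the third column come from two different vertices of another part.
    pair⇒p+q : ∀ {p q b d i c f g h} → b ≡ ι 0ℤ → d ≡ ι 0ℤ → i ≡ ι 0ℤ →
      c ≡ ι -1ℤ → f ≡ ι -1ℤ → g ≡ ι -1ℤ → h ≡ ι -1ℤ → J (det₃ p b c d q f g h i) → J (p + q)
    pair⇒p+q {p} {q} ≡.refl ≡.refl ≡.refl ≡.refl ≡.refl ≡.refl ≡.refl m = resp
      (solve 2 (λ p q → :- :det₃ p :0 :-1 :0 q :-1 :-1 :-1 :0 := p :+ q) refl p q) (neg m)

    -- This determinant is det C for K_{m,2} with m at least 3.
    p+q⇒pair : ∀ p q → J (p + q) →
      J (det₃ p (ι 0ℤ) (ι -1ℤ) (ι 0ℤ) q (ι -1ℤ) (ι -1ℤ) (ι -1ℤ) (ι 0ℤ))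
    p+q⇒pair p q h = resp
      (solve 2 (λ p q → :- (p :+ q) := :det₃ p :0 :-1 :0 q :-1 :-1 :-1 :0) refl p q) (neg h)

  minor₃∈-≡ : ∀ {m n} {A B : Matrix m n} → (∀ i j → A i j ≡ B i j) →
    ∀ a b c u v w → Generated (IsMinor 3 A) (minor₃ B a b c u v w)
  minor₃∈-≡ {A = A} A≡B a b c u v w = ~-respects
    (minor₃-~ {ρ = λ i → i} {σ = λ j → j} (λ i j → ≡⇒~ (≡.sym (A≡B i j))) a b c u v w)
    (minor₃∈ A a b c u v w)

  -- Graphs on four vertices

  data Triple₄ : (a b c : Fin 4) → Set where
    012# : Triple₄ 0F 1F 2F
    013# : Triple₄ 0F 1F 3F
    023# : Triple₄ 0F 2F 3F
    123# : Triple₄ 1F 2F 3F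

  triple₄ : ∀ {a b c} → a Fin.< b → b Fin.< c → Triple₄ a b c
  triple₄ {0F} {1F} {2F} _ _ = 012#
  triple₄ {0F} {1F} {3F} _ _ = 013#
  triple₄ {0F} {2F} {3F} _ _ = 023#
  triple₄ {1F} {2F} {3F} _ _ = 123#
  triple₄ {0F} {1F} {1F} _ (s≤s ())
  triple₄ {_} {2F} {1F} _ (s≤s ())
  triple₄ {_} {2F} {2F} _ (s≤s (s≤s ()))
  triple₄ {_} {3F} {1F} _ (s≤s ())
  triple₄ {_} {3F} {2F} _ (s≤s (s≤s ()))
  triple₄ {_} {3F} {3F} _ (s≤s (s≤s (s≤s ())))
  triple₄ {1F} {1F} (s≤s ()) _
  triple₄ {2F} {1F} (s≤s ()) _
  triple₄ {2F} {2F} (s≤s (s≤s ())) _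
  triple₄ {3F} {1F} (s≤s ()) _
  triple₄ {3F} {2F} (s≤s (s≤s ())) _

  :minor₃ : ∀ {k m n} → (Fin m → Fin n → Polynomial k) →
    (a b c : Fin m) (u v w : Fin n) → Polynomial k
  :minor₃ A a b c u v w =
    :det₃ (A a u) (A a v) (A a w) (A b u) (A b v) (A b w) (A c u) (A c v) (A c w)

  -- `cs` lists the coefficients of the minor on the generators `gs`. The `Triple₄` arguments
  -- determine the rows and columns, and the last argument compares normal forms.
  minor-by : ∀ {p k n} {S : Pred Carrier p} {ρ : Vec Carrier k} {gs : Vec (Polynomial k) n} →
    All (λ g → Generated S (⟦ g ⟧ ρ)) gs → (A : Fin 4 → Fin 4 → Polynomial k) →
    ∀ {a b c u v w} → Triple₄ a b c → Triple₄ u v w → (cs : Vec (Polynomial k) n) →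
    ⟦ :combination cs gs ⟧↓ ρ ≈ ⟦ :minor₃ A a b c u v w ⟧↓ ρ →
    Generated S (minor₃ (λ i j → ⟦ A i j ⟧ ρ) a b c u v w)
  minor-by {ρ = ρ} {gs} gs∈ A {a} {b} {c} {u} {v} {w} _ _ cs e =
    resp (prove ρ (:combination cs gs) (:minor₃ A a b c u v w) e) (combination∈ gs∈ cs)

  -- The diamond K₂,₁,₁, that is, K₄ minus an edge

  module Diamond (x₀ x₁ y z : Carrier) where

    private
      ρ : Vec Carrier 4
      ρ = x₀ ∷ x₁ ∷ y ∷ z ∷ []

      :x₀ :x₁ :y :z : Polynomial 4
      :x₀ = var 0F
      :x₁ = var 1F
      :y  = var 2F
      :z  = var 3F

      :M : Fin 4 → Fin 4 → Polynomial 4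
      :M i j = lookup (lookup
        ( (:x₀ ∷ :0  ∷ :-1 ∷ :-1 ∷ [])
        ∷ (:0  ∷ :x₁ ∷ :-1 ∷ :-1 ∷ [])
        ∷ (:-1 ∷ :-1 ∷ :y  ∷ :-1 ∷ [])
        ∷ (:-1 ∷ :-1 ∷ :-1 ∷ :z  ∷ [])
        ∷ []) i) j

      :gs : Vec (Polynomial 4) 4
      :gs = :x₀ :* :x₁ :+ :x₀ :+ :x₁ ∷ :x₀ :* :z :+ :x₀ ∷ :x₁ :* :z :+ :x₁
          ∷ :y :+ :z :+ :2 ∷ []

    M : Matrix 4 4
    M i j = ⟦ :M i j ⟧ ρ

    gs : List Carrier
    gs = x₀ * x₁ + x₀ + x₁ ∷ x₀ * z + x₀ ∷ x₁ * z + x₁ ∷ y + z + ι (+ 2) ∷ []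

    private
      gs∈ : All (λ g → ⟨ gs ⟩ (⟦ g ⟧ ρ)) :gs
      gs∈ = gen (here ≡.refl) ∷ gen (there (here ≡.refl)) ∷ gen (there (there (here ≡.refl)))
          ∷ gen (there (there (there (here ≡.refl)))) ∷ []

      minors : ∀ {a b c u v w} → Triple₄ a b c → Triple₄ u v w → ⟨ gs ⟩ (minor₃ M a b c u v w)
      -- Modulo the last generator y is -z - 2, and modulo the second x₀z is -x₀; this reduces x₀x₁y
      -- - x₀ - x₁ to minus the first generator.
      minors 012# 012# = minor-by gs∈ :M 012# 012# (:-1 ∷ :- :x₁ ∷ :0 ∷ :x₀ :* :x₁ ∷ []) refl
      minors 012# 013# = minor-by gs∈ :M 012# 013# (:-1 ∷ :0 ∷ :0 ∷ :0 ∷ []) refl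
      minors 012# 023# = minor-by gs∈ :M 012# 023# (:0 ∷ :-1 ∷ :0 ∷ :x₀ ∷ []) refl
      minors 012# 123# = minor-by gs∈ :M 012# 123# (:0 ∷ :0 ∷ :1 ∷ :- :x₁ ∷ []) refl
      minors 013# 012# = minor-by gs∈ :M 013# 012# (:-1 ∷ :0 ∷ :0 ∷ :0 ∷ []) refl
      minors 013# 013# = minor-by gs∈ :M 013# 013# (:-1 ∷ :x₁ ∷ :0 ∷ :0 ∷ []) refl
      minors 013# 023# = minor-by gs∈ :M 013# 023# (:0 ∷ :-1 ∷ :0 ∷ :0 ∷ []) refl
      minors 013# 123# = minor-by gs∈ :M 013# 123# (:0 ∷ :0 ∷ :1 ∷ :0 ∷ []) refl
      minors 023# 012# = minor-by gs∈ :M 023# 012# (:0 ∷ :-1 ∷ :0 ∷ :x₀ ∷ []) refl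
      minors 023# 013# = minor-by gs∈ :M 023# 013# (:0 ∷ :-1 ∷ :0 ∷ :0 ∷ []) refl
      -- This minor is `τ x₀ y z`, written as x₀(y + 1)(z + 1) - (x₀ + 1)(y + z + 2).
      minors 023# 023# = minor-by gs∈ :M 023# 023# (:0 ∷ :y :+ :1 ∷ :0 ∷ :- :x₀ :- :1 ∷ []) refl
      minors 023# 123# = minor-by gs∈ :M 023# 123# (:0 ∷ :0 ∷ :0 ∷ :-1 ∷ []) refl
      minors 123# 012# = minor-by gs∈ :M 123# 012# (:0 ∷ :0 ∷ :1 ∷ :- :x₁ ∷ []) refl
      minors 123# 013# = minor-by gs∈ :M 123# 013# (:0 ∷ :0 ∷ :1 ∷ :0 ∷ []) refl
      minors 123# 023# = minor-by gs∈ :M 123# 023# (:0 ∷ :0 ∷ :0 ∷ :-1 ∷ []) refl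
      minors 123# 123# = minor-by gs∈ :M 123# 123# (:0 ∷ :0 ∷ :y :+ :1 ∷ :- :x₁ :- :1 ∷ []) refl

    diamond-minors⊆ : ∀ {A : Matrix 4 4} → (∀ i j → A i j ≡ M i j) →
      Generated (IsMinor 3 A) ⊆ ⟨ gs ⟩
    diamond-minors⊆ A≡M = minors-≡⊆ A≡M λ a<b b<c u<v v<w →
      minors (triple₄ a<b b<c) (triple₄ u<v v<w)

    ⊆diamond-minors : ∀ {A : Matrix 4 4} → (∀ i j → A i j ≡ M i j) →
      ⟨ gs ⟩ ⊆ Generated (IsMinor 3 A)
    ⊆diamond-minors {A} A≡M = Generated-minimal gs⊆
      where
      minor : ∀ a b c u v w → Generated (IsMinor 3 A) (minor₃ M a b c u v w)
      minor = minor₃∈-≡ A≡M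

      gs⊆ : (_∈ gs) ⊆ Generated (IsMinor 3 A)
      gs⊆ (here ≡.refl) = resp
        (solve 2 (λ x₀ x₁ → :- :det₃ x₀ :0 :-1 :0 x₁ :-1 :-1 :-1 :-1
          := x₀ :* x₁ :+ x₀ :+ x₁) refl x₀ x₁)
        (neg (minor 0F 1F 2F 0F 1F 3F))
      gs⊆ (there (here ≡.refl)) = resp
        (solve 2 (λ x₀ z → :- :det₃ x₀ :-1 :-1 :0 :-1 :-1 :-1 :-1 z := x₀ :* z :+ x₀) refl x₀ z)
        (neg (minor 0F 1F 3F 0F 2F 3F))
      gs⊆ (there (there (here ≡.refl))) = resp
        (solve 2 (λ x₁ z → :det₃ :0 :-1 :-1 x₁ :-1 :-1 :-1 :-1 z := x₁ :* z :+ x₁) refl x₁ z)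
        (minor 0F 1F 3F 1F 2F 3F)
      gs⊆ (there (there (there (here ≡.refl)))) = resp
        (solve 2 (λ y z → :- :det₃ :0 :-1 :-1 :-1 y :-1 :-1 :-1 z := y :+ z :+ :2) refl y z)
        (neg (minor 0F 2F 3F 1F 2F 3F))

  -- The square K₂,₂, that is, the 4-cycle

  module Square (x₀ x₁ y₀ y₁ : Carrier) where

    private
      ρ : Vec Carrier 4
      ρ = x₀ ∷ x₁ ∷ y₀ ∷ y₁ ∷ []

      :x₀ :x₁ :y₀ :y₁ : Polynomial 4
      :x₀ = var 0F
      :x₁ = var 1F
      :y₀ = var 2F
      :y₁ = var 3F

      :M : Fin 4 → Fin 4 → Polynomial 4
      :M i j = lookup (lookup
        ( (:x₀ ∷ :0  ∷ :-1 ∷ :-1 ∷ [])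
        ∷ (:0  ∷ :x₁ ∷ :-1 ∷ :-1 ∷ [])
        ∷ (:-1 ∷ :-1 ∷ :y₀ ∷ :0  ∷ [])
        ∷ (:-1 ∷ :-1 ∷ :0  ∷ :y₁ ∷ [])
        ∷ []) i) j

      :gs : Vec (Polynomial 4) 3
      :gs = :x₁ :* :y₁ ∷ :x₀ :+ :x₁ ∷ :y₀ :+ :y₁ ∷ []

    M : Matrix 4 4
    M i j = ⟦ :M i j ⟧ ρ

    gs : List Carrier
    gs = x₁ * y₁ ∷ x₀ + x₁ ∷ y₀ + y₁ ∷ []

    private
      gs∈ : All (λ g → ⟨ gs ⟩ (⟦ g ⟧ ρ)) :gs
      gs∈ = gen (here ≡.refl) ∷ gen (there (here ≡.refl)) ∷ gen (there (there (here ≡.refl))) ∷ []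

      minors : ∀ {a b c u v w} → Triple₄ a b c → Triple₄ u v w → ⟨ gs ⟩ (minor₃ M a b c u v w)
      -- Modulo the two sums, every product of some xᵢ with some yⱼ is x₁y₁ up to sign, so a single
      -- product suffices as a generator.
      minors 012# 012# = minor-by gs∈ :M 012# 012# (:- :x₀ ∷ :-1 ∷ :x₀ :* :x₁ ∷ []) refl
      minors 012# 013# = minor-by gs∈ :M 012# 013# (:0 ∷ :-1 ∷ :0 ∷ []) refl
      minors 012# 023# = minor-by gs∈ :M 012# 023# (:1 ∷ :y₀ ∷ :- :x₁ ∷ []) refl
      minors 012# 123# = minor-by gs∈ :M 012# 123# (:1 ∷ :0 ∷ :- :x₁ ∷ []) refl
      minors 013# 012# = minor-by gs∈ :M 013# 012# (:0 ∷ :-1 ∷ :0 ∷ []) refl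
      minors 013# 013# = minor-by gs∈ :M 013# 013# (:x₀ ∷ :-1 ∷ :0 ∷ []) refl
      minors 013# 023# = minor-by gs∈ :M 013# 023# (:1 ∷ :- :y₁ ∷ :0 ∷ []) refl
      minors 013# 123# = minor-by gs∈ :M 013# 123# (:1 ∷ :0 ∷ :0 ∷ []) refl
      minors 023# 012# = minor-by gs∈ :M 023# 012# (:1 ∷ :y₀ ∷ :- :x₁ ∷ []) refl
      minors 023# 013# = minor-by gs∈ :M 023# 013# (:1 ∷ :- :y₁ ∷ :0 ∷ []) refl
      minors 023# 023# = minor-by gs∈ :M 023# 023# (:- :y₀ ∷ :y₀ :* :y₁ ∷ :-1 ∷ []) refl
      minors 023# 123# = minor-by gs∈ :M 023# 123# (:0 ∷ :0 ∷ :-1 ∷ []) refl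
      minors 123# 012# = minor-by gs∈ :M 123# 012# (:1 ∷ :0 ∷ :- :x₁ ∷ []) refl
      minors 123# 013# = minor-by gs∈ :M 123# 013# (:1 ∷ :0 ∷ :0 ∷ []) refl
      minors 123# 023# = minor-by gs∈ :M 123# 023# (:0 ∷ :0 ∷ :-1 ∷ []) refl
      minors 123# 123# = minor-by gs∈ :M 123# 123# (:y₀ ∷ :0 ∷ :-1 ∷ []) refl

    square-minors⊆ : ∀ {A : Matrix 4 4} → (∀ i j → A i j ≡ M i j) →
      Generated (IsMinor 3 A) ⊆ ⟨ gs ⟩
    square-minors⊆ A≡M = minors-≡⊆ A≡M λ a<b b<c u<v v<w →
      minors (triple₄ a<b b<c) (triple₄ u<v v<w)

    ⊆square-minors : ∀ {A : Matrix 4 4} → (∀ i j → A i j ≡ M i j) →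
      ⟨ gs ⟩ ⊆ Generated (IsMinor 3 A)
    ⊆square-minors {A} A≡M = Generated-minimal gs⊆
      where
      minor : ∀ a b c u v w → Generated (IsMinor 3 A) (minor₃ M a b c u v w)
      minor = minor₃∈-≡ A≡M

      gs⊆ : (_∈ gs) ⊆ Generated (IsMinor 3 A)
      gs⊆ (here ≡.refl) = resp
        (solve 2 (λ x₁ y₁ → :det₃ :0 :-1 :-1 x₁ :-1 :-1 :-1 :0 y₁ := x₁ :* y₁) refl x₁ y₁)
        (minor 0F 1F 3F 1F 2F 3F)
      gs⊆ (there (here ≡.refl)) =
        pair⇒p+q ≡.refl ≡.refl ≡.refl ≡.refl ≡.refl ≡.refl ≡.refl (minor 0F 1F 2F 0F 1F 3F)
      gs⊆ (there (there (here ≡.refl))) =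
        pair⇒p+q ≡.refl ≡.refl ≡.refl ≡.refl ≡.refl ≡.refl ≡.refl (minor 2F 3F 0F 2F 3F 1F)

open import Defs

-- Integer constants in the polynomial ring

con-morphism : ∀ N → ℤ.+-*-rawRing -Raw-AlmostCommutative⟶ fromCommutativeRing (ℤ[X] N)
con-morphism N = record
  { ⟦_⟧    = con
  -- `con c + con d` is a sum of two terms and `con 0ℤ` a term with coefficient 0, so additivity and
  -- `0-homo` are checked coefficient by coefficient.
  ; +-homo = λ c d → mk≈ λ μ → +-lemma c d (does (Vec.replicate N 0 ≟ᵐ μ))
  ; *-homo = λ c d → CommutativeRing.reflexive (ℤ[X] N)
      (≡.cong (λ α → [ c ℤ.* d , α ])
        (≡.sym (Vec.zipWith-identityˡ ℕ.+-identityˡ (Vec.replicate N 0))))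
  ; -‿homo = λ _ → CommutativeRing.refl (ℤ[X] N)
  ; 0-homo = mk≈ λ μ → 0-lemma (does (Vec.replicate N 0 ≟ᵐ μ))
  ; 1-homo = CommutativeRing.refl (ℤ[X] N)
  }
  where
  +-lemma : ∀ c d b → (if b then c ℤ.+ d else 0ℤ) ℤ.+ 0ℤ ≡
    (if b then c else 0ℤ) ℤ.+ ((if b then d else 0ℤ) ℤ.+ 0ℤ)
  +-lemma c d true  = ℤ.+-assoc c d 0ℤ
  +-lemma c d false = ≡.refl

  0-lemma : ∀ b → (if b then 0ℤ else 0ℤ) ℤ.+ 0ℤ ≡ 0ℤ
  0-lemma true  = ≡.refl
  0-lemma false = ≡.refl

-- The generalized Laplacian of a complete tripartite graph

module CompleteTripartite (m n o : ℕ) where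

  open Tripartite m n o public
  open RingTheory (ℤ[X] (m ℕ.+ n ℕ.+ o)) hiding (⟨_⟩) public
  open Determinants (ℤ[X] (m ℕ.+ n ℕ.+ o)) (con-morphism _) public

  L : Matrix (m ℕ.+ n ℕ.+ o) (m ℕ.+ n ℕ.+ o)
  L = generalizedLaplacian K

  α : Fin m → Fin (m ℕ.+ n ℕ.+ o)
  α i = i ↑ˡ n ↑ˡ o

  β : Fin n → Fin (m ℕ.+ n ℕ.+ o)
  β j = (m ↑ʳ j) ↑ˡ o

  γ : Fin o → Fin (m ℕ.+ n ℕ.+ o)
  γ k = (m ℕ.+ n) ↑ʳ k

  data Vertex : Fin (m ℕ.+ n ℕ.+ o) → Set where
    in-α : ∀ i → Vertex (α i)
    in-β : ∀ j → Vertex (β j)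
    in-γ : ∀ k → Vertex (γ k)

  vertex : ∀ u → Vertex u
  vertex u with Fin.splitAt (m ℕ.+ n) u in eq
  ... | inj₂ k rewrite ≡.sym (Fin.splitAt⁻¹-↑ʳ eq) = in-γ k
  ... | inj₁ v rewrite ≡.sym (Fin.splitAt⁻¹-↑ˡ eq) with Fin.splitAt m v in eq′
  ...   | inj₁ i rewrite ≡.sym (Fin.splitAt⁻¹-↑ˡ eq′) = in-α i
  ...   | inj₂ j rewrite ≡.sym (Fin.splitAt⁻¹-↑ʳ {m} eq′) = in-β j

  part-α : ∀ i → part (α i) ≡ 0F
  part-α i rewrite Fin.splitAt-↑ˡ (m ℕ.+ n) (i ↑ˡ n) o | Fin.splitAt-↑ˡ m i n = ≡.refl

  part-β : ∀ j → part (β j) ≡ 1F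
  part-β j rewrite Fin.splitAt-↑ˡ (m ℕ.+ n) (m ↑ʳ j) o | Fin.splitAt-↑ʳ m n j = ≡.refl

  part-γ : ∀ k → part (γ k) ≡ 2F
  part-γ k rewrite Fin.splitAt-↑ʳ (m ℕ.+ n) o k = ≡.refl

  α-injective : ∀ i i′ → α i ≡ α i′ → i ≡ i′
  α-injective i i′ = Fin.↑ˡ-injective n i i′ ∘ Fin.↑ˡ-injective o (i ↑ˡ n) (i′ ↑ˡ n)

  β-injective : ∀ j j′ → β j ≡ β j′ → j ≡ j′
  β-injective j j′ = Fin.↑ʳ-injective m j j′ ∘ Fin.↑ˡ-injective o (m ↑ʳ j) (m ↑ʳ j′)

  γ-injective : ∀ k k′ → γ k ≡ γ k′ → k ≡ k′
  γ-injective k k′ = Fin.↑ʳ-injective (m ℕ.+ n) k k′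

  L-diagonal : ∀ u → L u u ≡ X u
  L-diagonal u rewrite dec-true (u Fin.≟ u) ≡.refl = ≡.refl

  L-same : ∀ {u v} → u ≢ v → part u ≡ part v → L u v ≡ con 0ℤ
  L-same {u} {v} u≢v p rewrite dec-false (u Fin.≟ v) u≢v | dec-true (part u Fin.≟ part v) p = ≡.refl

  L-different : ∀ {u v s t} → part u ≡ s → part v ≡ t → s ≢ t → L u v ≡ con -1ℤ
  L-different {u} {v} ≡.refl ≡.refl s≢t
    rewrite dec-false (u Fin.≟ v) (s≢t ∘ ≡.cong part) | dec-false (part u Fin.≟ part v) s≢t = ≡.refl

  L-α≢ : ∀ i i′ → i ≢ i′ → L (α i) (α i′) ≡ con 0ℤ
  L-α≢ i i′ i≢i′ = L-same (i≢i′ ∘ α-injective i i′) (≡.trans (part-α i) (≡.sym (part-α i′)))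

  L-β≢ : ∀ j j′ → j ≢ j′ → L (β j) (β j′) ≡ con 0ℤ
  L-β≢ j j′ j≢j′ = L-same (j≢j′ ∘ β-injective j j′) (≡.trans (part-β j) (≡.sym (part-β j′)))

  L-γ≢ : ∀ k k′ → k ≢ k′ → L (γ k) (γ k′) ≡ con 0ℤ
  L-γ≢ k k′ k≢k′ = L-same (k≢k′ ∘ γ-injective k k′) (≡.trans (part-γ k) (≡.sym (part-γ k′)))

  L-αβ : ∀ i j → L (α i) (β j) ≡ con -1ℤ
  L-αβ i j = L-different (part-α i) (part-β j) λ ()

  L-αγ : ∀ i k → L (α i) (γ k) ≡ con -1ℤ
  L-αγ i k = L-different (part-α i) (part-γ k) λ ()

  L-βα : ∀ j i → L (β j) (α i) ≡ con -1ℤ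
  L-βα j i = L-different (part-β j) (part-α i) λ ()

  L-βγ : ∀ j k → L (β j) (γ k) ≡ con -1ℤ
  L-βγ j k = L-different (part-β j) (part-γ k) λ ()

  L-γα : ∀ k i → L (γ k) (α i) ≡ con -1ℤ
  L-γα k i = L-different (part-γ k) (part-α i) λ ()

  L-γβ : ∀ k j → L (γ k) (β j) ≡ con -1ℤ
  L-γβ k j = L-different (part-γ k) (part-β j) λ ()

  -- Rows and columns each take one vertex from every part, so all entries off the diagonal are -1.
  -- Each diagonal entry is an indeterminate when the two vertices of that part agree, and 0 when
  -- they differ.
  transversal∈ : ∀ {p q r} i i′ j j′ k k′ →
    L (α i) (α i′) ≡ p → L (β j) (β j′) ≡ q → L (γ k) (γ k′) ≡ r → I₃ (τ p q r)
  transversal∈ i i′ j j′ k k′ P Q R = τ∈ P Q R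
    (L-αβ i j′) (L-αγ i k′) (L-βα j i′) (L-βγ j k′) (L-γα k i′) (L-γβ k j′)
    (minor₃∈ L (α i) (β j) (γ k) (α i′) (β j′) (γ k′))

  -- The minor on rows u, u′, v and columns u, u′, v′ is - (X u + X u′).
  pair∈ : ∀ u u′ v v′ {s t} → u ≢ u′ → v ≢ v′ → s ≢ t →
    part u ≡ s → part u′ ≡ s → part v ≡ t → part v′ ≡ t → I₃ (X u + X u′)
  pair∈ u u′ v v′ u≢u′ v≢v′ s≢t pu pu′ pv pv′ =
    ≡.subst₂ (λ f g → I₃ (f + g)) (L-diagonal u) (L-diagonal u′)
      (pair⇒p+q {p = L u u} {q = L u′ u′}
        (L-same u≢u′ (≡.trans pu (≡.sym pu′)))
        (L-same (u≢u′ ∘ ≡.sym) (≡.trans pu′ (≡.sym pu)))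
        (L-same v≢v′ (≡.trans pv (≡.sym pv′)))
        (L-different pu pv′ s≢t) (L-different pu′ pv′ s≢t)
        (L-different pv pu (s≢t ∘ ≡.sym)) (L-different pv pu′ (s≢t ∘ ≡.sym))
        (minor₃∈ L u u′ v u u′ v′))

  -- The minor on rows u, u′, w and columns u, u″, w is - X u.
  triple∈ : ∀ u u′ u″ w {s t} → u ≢ u′ → u ≢ u″ → u′ ≢ u″ → s ≢ t →
    part u ≡ s → part u′ ≡ s → part u″ ≡ s → part w ≡ t → I₃ (X u)
  triple∈ u u′ u″ w u≢u′ u≢u″ u′≢u″ s≢t pu pu′ pu″ pw =
    ≡.subst I₃ (L-diagonal u)
      (triple⇒p
        (L-same u≢u″ (≡.trans pu (≡.sym pu″)))
        (L-same (u≢u′ ∘ ≡.sym) (≡.trans pu′ (≡.sym pu)))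
        (L-same u′≢u″ (≡.trans pu′ (≡.sym pu″)))
        (L-different pu pw s≢t) (L-different pu′ pw s≢t)
        (L-different pw pu (s≢t ∘ ≡.sym)) (L-different pw pu″ (s≢t ∘ ≡.sym))
        (minor₃∈ L u u′ w u u″ w))

  module _ {ℓ′} {S : Pred (Poly (m ℕ.+ n ℕ.+ o)) ℓ′} where

    part-zero : ∀ {u v} → part u ≡ part v → Generated S (X u) → _~_ {S = S} (L u v) (con 0ℤ)
    part-zero {u} {v} pu≡pv Xu∈ with u Fin.≟ v
    ... | yes ≡.refl = sub Xu∈ ι0∈
    ... | no u≢v rewrite dec-true (part u Fin.≟ part v) pu≡pv = ~-refl (con 0ℤ)

    α-zero : (∀ i → Generated S (x i)) → ∀ i i′ → _~_ {S = S} (L (α i) (α i′)) (con 0ℤ)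
    α-zero x∈ i i′ = part-zero (≡.trans (part-α i) (≡.sym (part-α i′))) (x∈ i)

    β-zero : (∀ j → Generated S (y j)) → ∀ j j′ → _~_ {S = S} (L (β j) (β j′)) (con 0ℤ)
    β-zero y∈ j j′ = part-zero (≡.trans (part-β j) (≡.sym (part-β j′))) (y∈ j)

    γ-zero : (∀ k → Generated S (z k)) → ∀ k k′ → _~_ {S = S} (L (γ k) (γ k′)) (con 0ℤ)
    γ-zero z∈ k k′ = part-zero (≡.trans (part-γ k) (≡.sym (part-γ k′))) (z∈ k)

    I₃⊆-by-parts : ∀ p q r →
      (∀ i i′ → _~_ {S = S} (L (α i) (α i′)) p) →
      (∀ j j′ → _~_ {S = S} (L (β j) (β j′)) q) →
      (∀ k k′ → _~_ {S = S} (L (γ k) (γ k′)) r) →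
      Generated S (τ p q r) → I₃ ⊆ Generated S
    I₃⊆-by-parts p q r Lα~p Lβ~q Lγ~r =
      minors-factor⊆ C (λ u → class (vertex u)) (λ v → class (vertex v))
        λ u v → L~C (vertex u) (vertex v)
      where
      class : ∀ {u} → Vertex u → Fin 3
      class (in-α _) = 0F
      class (in-β _) = 1F
      class (in-γ _) = 2F

      C : Matrix 3 3
      C 0F 0F = p
      C 1F 1F = q
      C 2F 2F = r
      C _  _  = con -1ℤ

      L~C : ∀ {u v} (s : Vertex u) (t : Vertex v) → _~_ {S = S} (L u v) (C (class s) (class t))
      L~C (in-α i) (in-α i′) = Lα~p i i′
      L~C (in-α i) (in-β j)  = ≡⇒~ (L-αβ i j)
      L~C (in-α i) (in-γ k)  = ≡⇒~ (L-αγ i k)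
      L~C (in-β j) (in-α i)  = ≡⇒~ (L-βα j i)
      L~C (in-β j) (in-β j′) = Lβ~q j j′
      L~C (in-β j) (in-γ k)  = ≡⇒~ (L-βγ j k)
      L~C (in-γ k) (in-α i)  = ≡⇒~ (L-γα k i)
      L~C (in-γ k) (in-β j)  = ≡⇒~ (L-γβ k j)
      L~C (in-γ k) (in-γ k′) = Lγ~r k k′

  ⟨⟩⊆I₃ : ∀ {fs} → ListAll.All I₃ fs → ⟨ fs ⟩ ⊆ I₃
  ⟨⟩⊆I₃ fs∈ = Generated-minimal (ListAll.lookup fs∈)

-- The eight cases

two-others : ∀ {k} (i : Fin (3 ℕ.+ k)) → ∃₂ λ j j′ → i ≢ j × i ≢ j′ × j ≢ j′
two-others 0F            = 1F , 2F , (λ ()) , (λ ()) , λ ()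
two-others 1F            = 0F , 2F , (λ ()) , (λ ()) , λ ()
two-others (suc (suc _)) = 0F , 1F , (λ ()) , (λ ()) , λ ()

I₃-≥2-≥2-≥2 : ∀ m n o → let open Tripartite m n o in
  m ≥ 2 → n ≥ 2 → o ≥ 2 → I₃ ≐ ⟨ con (+ 2) ∷ xs ++ ys ++ zs ⟩
I₃-≥2-≥2-≥2 m@(suc (suc _)) n@(suc (suc _)) o@(suc (suc _))
  (s≤s (s≤s _)) (s≤s (s≤s _)) (s≤s (s≤s _)) =
  I₃⊆-by-parts (con 0ℤ) (con 0ℤ) (con 0ℤ)
    (α-zero λ i → gen (there (∈-++⁺ˡ (∈-tabulate⁺ {f = x} i))))
    (β-zero λ j → gen (there (∈-++⁺ʳ xs (∈-++⁺ˡ (∈-tabulate⁺ {f = y} j)))))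
    (γ-zero λ k → gen (there (∈-++⁺ʳ xs (∈-++⁺ʳ ys (∈-tabulate⁺ {f = z} k)))))
    (2⇒τ000 (gen (here ≡.refl))) ,
  ⟨⟩⊆I₃ (τ000⇒2 τ000 ∷ ListAll.++⁺ (ListAll.tabulate⁺ x∈)
    (ListAll.++⁺ (ListAll.tabulate⁺ y∈) (ListAll.tabulate⁺ z∈)))
  where
  open CompleteTripartite m n o

  τ000 : I₃ (τ (con 0ℤ) (con 0ℤ) (con 0ℤ))
  τ000 = transversal∈ 0F 1F 0F 1F 0F 1F (L-α≢ 0F 1F λ ()) (L-β≢ 0F 1F λ ()) (L-γ≢ 0F 1F λ ())

  x∈ : ∀ i → I₃ (x i)
  x∈ i = τp0r⇒p (x i) (con 0ℤ) τ000
    (transversal∈ i i 0F 1F 0F 1F (L-diagonal (α i)) (L-β≢ 0F 1F λ ()) (L-γ≢ 0F 1F λ ()))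

  y∈ : ∀ j → I₃ (y j)
  y∈ j = τ0qr⇒q (y j) (con 0ℤ) τ000
    (transversal∈ 0F 1F j j 0F 1F (L-α≢ 0F 1F λ ()) (L-diagonal (β j)) (L-γ≢ 0F 1F λ ()))

  z∈ : ∀ k → I₃ (z k)
  z∈ k = τ00r⇒r (z k) τ000
    (transversal∈ 0F 1F 0F 1F k k (L-α≢ 0F 1F λ ()) (L-β≢ 0F 1F λ ()) (L-diagonal (γ k)))

I₃-≥2-≥2-1 : ∀ m n → let open Tripartite m n 1 in
  m ≥ 2 → n ≥ 2 → I₃ ≐ ⟨ xs ++ ys ++ [ z 0F + con (+ 2) ] ⟩
I₃-≥2-≥2-1 m@(suc (suc _)) n@(suc (suc _)) (s≤s (s≤s _)) (s≤s (s≤s _)) =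
  I₃⊆-by-parts (con 0ℤ) (con 0ℤ) (z 0F)
    (α-zero λ i → gen (∈-++⁺ˡ (∈-tabulate⁺ {f = x} i)))
    (β-zero λ j → gen (∈-++⁺ʳ xs (∈-++⁺ˡ (∈-tabulate⁺ {f = y} j))))
    (λ { 0F 0F → ≡⇒~ (L-diagonal (γ 0F)) })
    (r+2⇒τ00r (z 0F) (gen (∈-++⁺ʳ xs (∈-++⁺ʳ ys (here ≡.refl))))) ,
  ⟨⟩⊆I₃ (ListAll.++⁺ (ListAll.tabulate⁺ x∈)
    (ListAll.++⁺ (ListAll.tabulate⁺ y∈) (τ00r⇒r+2 (z 0F) τ00z ∷ [])))
  where
  open CompleteTripartite m n 1

  -- The third part has a single vertex, so its indeterminate cannot be avoided on the diagonal, and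
  -- z₁ + 2 takes the place of 2.
  τ00z : I₃ (τ (con 0ℤ) (con 0ℤ) (z 0F))
  τ00z = transversal∈ 0F 1F 0F 1F 0F 0F (L-α≢ 0F 1F λ ()) (L-β≢ 0F 1F λ ()) (L-diagonal (γ 0F))

  x∈ : ∀ i → I₃ (x i)
  x∈ i = τp0r⇒p (x i) (z 0F) τ00z
    (transversal∈ i i 0F 1F 0F 0F (L-diagonal (α i)) (L-β≢ 0F 1F λ ()) (L-diagonal (γ 0F)))

  y∈ : ∀ j → I₃ (y j)
  y∈ j = τ0qr⇒q (y j) (z 0F) τ00z
    (transversal∈ 0F 1F j j 0F 0F (L-α≢ 0F 1F λ ()) (L-diagonal (β j)) (L-diagonal (γ 0F)))

α-triple∈ : ∀ k n o → let open CompleteTripartite (3 ℕ.+ k) n o in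
  ∀ w {t} → part w ≡ t → 0F ≢ t → ∀ i → I₃ (x i)
α-triple∈ k n o w pw 0≢t i =
  -- `α j` serves only as a row and `α j′` only as a column, so neither of their indeterminates
  -- enters the minor; this is where the part needs three vertices.
  let j , j′ , i≢j , i≢j′ , j≢j′ = two-others i in
  triple∈ (α i) (α j) (α j′) w
    (i≢j ∘ α-injective i j) (i≢j′ ∘ α-injective i j′) (j≢j′ ∘ α-injective j j′) 0≢t
    (part-α i) (part-α j) (part-α j′) pw
  where open CompleteTripartite (3 ℕ.+ k) n o

I₃-≥3-1-1 : ∀ m → let open Tripartite m 1 1 in
  m ≥ 3 → I₃ ≐ ⟨ xs ++ [ y 0F + z 0F + con (+ 2) ] ⟩
I₃-≥3-1-1 m@(suc (suc (suc k))) (s≤s (s≤s (s≤s _))) =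
  I₃⊆-by-parts (con 0ℤ) (y 0F) (z 0F)
    (α-zero λ i → gen (∈-++⁺ˡ (∈-tabulate⁺ {f = x} i)))
    (λ { 0F 0F → ≡⇒~ (L-diagonal (β 0F)) })
    (λ { 0F 0F → ≡⇒~ (L-diagonal (γ 0F)) })
    (q+r+2⇒τ0qr (y 0F) (z 0F) (gen (∈-++⁺ʳ xs (here ≡.refl)))) ,
  ⟨⟩⊆I₃ (ListAll.++⁺ (ListAll.tabulate⁺ (α-triple∈ k 1 1 (β 0F) (part-β 0F) λ ()))
    (τ0qr⇒q+r+2 (y 0F) (z 0F)
      (transversal∈ 0F 1F 0F 0F 0F 0F (L-α≢ 0F 1F λ ()) (L-diagonal (β 0F)) (L-diagonal (γ 0F))) ∷ []))
  where open CompleteTripartite m 1 1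

I₃-≥3-≥3-0 : ∀ m n → let open Tripartite m n 0 in
  m ≥ 3 → n ≥ 3 → I₃ ≐ ⟨ xs ++ ys ⟩
I₃-≥3-≥3-0 m@(suc (suc (suc k))) n@(suc (suc (suc _))) (s≤s (s≤s (s≤s _))) (s≤s (s≤s (s≤s _))) =
  I₃⊆-by-parts (con 0ℤ) (con 0ℤ) (- con 0ℤ + (- con (+ 2)))
    (α-zero λ i → gen (∈-++⁺ˡ (∈-tabulate⁺ {f = x} i)))
    (β-zero λ j → gen (∈-++⁺ʳ xs (∈-tabulate⁺ {f = y} j)))
    (λ ())
    (τ-degenerate (con 0ℤ)) ,
  ⟨⟩⊆I₃ (ListAll.++⁺ (ListAll.tabulate⁺ (α-triple∈ k n 0 (β 0F) (part-β 0F) λ ()))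
    (ListAll.tabulate⁺ y∈))
  where
  open CompleteTripartite m n 0

  y∈ : ∀ j → I₃ (y j)
  y∈ j =
    let j′ , j″ , j≢j′ , j≢j″ , j′≢j″ = two-others j in
    triple∈ (β j) (β j′) (β j″) (α 0F)
      (j≢j′ ∘ β-injective j j′) (j≢j″ ∘ β-injective j j″) (j′≢j″ ∘ β-injective j′ j″) (λ ())
      (part-β j) (part-β j′) (part-β j″) (part-α 0F)

I₃-≥3-2-0 : ∀ m → let open Tripartite m 2 0 in
  m ≥ 3 → I₃ ≐ ⟨ xs ++ [ y 0F + y 1F ] ⟩
I₃-≥3-2-0 m@(suc (suc (suc k))) (s≤s (s≤s (s≤s _))) =
  minors-factor⊆ C (λ u → class (vertex u)) (λ v → class (vertex v))
    (λ u v → L~C (vertex u) (vertex v)) (p+q⇒pair (y 0F) (y 1F) (gen (∈-++⁺ʳ xs (here ≡.refl)))) ,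
  ⟨⟩⊆I₃ (ListAll.++⁺ (ListAll.tabulate⁺ (α-triple∈ k 2 0 (β 0F) (part-β 0F) λ ()))
    (pair∈ (β 0F) (β 1F) (α 0F) (α 1F)
      (λ e → case β-injective 0F 1F e of λ ()) (λ e → case α-injective 0F 1F e of λ ()) (λ ())
      (part-β 0F) (part-β 1F) (part-α 0F) (part-α 1F) ∷ []))
  where
  open CompleteTripartite m 2 0

  -- Only the sum of the two `y` lies in the ideal, so the second part splits into two singleton
  -- classes, and the whole first part is the third class.
  class : ∀ {u} → Vertex u → Fin 3
  class (in-β j) = j ↑ˡ 1
  class (in-α _) = 2F

  C : Matrix 3 3
  C 0F 0F = y 0F
  C 1F 1F = y 1F
  C 0F 2F = con -1ℤ
  C 1F 2F = con -1ℤ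
  C 2F 0F = con -1ℤ
  C 2F 1F = con -1ℤ
  -- This covers the two entries between the `y` vertices, which are 0 exactly, and the first part
  -- with itself, which is 0 modulo `xs`.
  C _  _  = con 0ℤ

  L~C : ∀ {u v} (s : Vertex u) (t : Vertex v) →
    _~_ {S = _∈ xs ++ [ y 0F + y 1F ]} (L u v) (C (class s) (class t))
  L~C (in-α i)  (in-α i′) = α-zero (λ i → gen (∈-++⁺ˡ (∈-tabulate⁺ {f = x} i))) i i′
  L~C (in-α i)  (in-β 0F) = ≡⇒~ (L-αβ i 0F)
  L~C (in-α i)  (in-β 1F) = ≡⇒~ (L-αβ i 1F)
  L~C (in-β 0F) (in-α i)  = ≡⇒~ (L-βα 0F i)
  L~C (in-β 1F) (in-α i)  = ≡⇒~ (L-βα 1F i)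
  L~C (in-β 0F) (in-β 0F) = ≡⇒~ (L-diagonal (β 0F))
  L~C (in-β 0F) (in-β 1F) = ≡⇒~ (L-β≢ 0F 1F λ ())
  L~C (in-β 1F) (in-β 0F) = ≡⇒~ (L-β≢ 1F 0F λ ())
  L~C (in-β 1F) (in-β 1F) = ≡⇒~ (L-diagonal (β 1F))

I₃-≥3-1-0 : ∀ m → let open Tripartite m 1 0 in
  m ≥ 3 → I₃ ≐ ⟨ xs ⟩
I₃-≥3-1-0 m@(suc (suc (suc k))) (s≤s (s≤s (s≤s _))) =
  I₃⊆-by-parts (con 0ℤ) (y 0F) (- y 0F + (- con (+ 2)))
    (α-zero λ i → gen (∈-tabulate⁺ {f = x} i))
    (λ { 0F 0F → ≡⇒~ (L-diagonal (β 0F)) })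
    (λ ())
    (τ-degenerate (y 0F)) ,
  ⟨⟩⊆I₃ (ListAll.tabulate⁺ (α-triple∈ k 1 0 (β 0F) (part-β 0F) λ ()))
  where open CompleteTripartite m 1 0

I₃-2-1-1 : let open Tripartite 2 1 1 in
  I₃ ≐ ⟨ x 0F * x 1F + x 0F + x 1F
       ∷ x 0F * z 0F + x 0F
       ∷ x 1F * z 0F + x 1F
       ∷ y 0F + z 0F + con (+ 2)
       ∷ [] ⟩
I₃-2-1-1 = diamond-minors⊆ L≡M , ⊆diamond-minors L≡M
  where
  open CompleteTripartite 2 1 1
  open Diamond (x 0F) (x 1F) (y 0F) (z 0F)

  L≡M : ∀ i j → L i j ≡ M i j
  L≡M = λ where
    0F 0F → ≡.refl
    0F 1F → ≡.refl
    0F 2F → ≡.refl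
    0F 3F → ≡.refl
    1F 0F → ≡.refl
    1F 1F → ≡.refl
    1F 2F → ≡.refl
    1F 3F → ≡.refl
    2F 0F → ≡.refl
    2F 1F → ≡.refl
    2F 2F → ≡.refl
    2F 3F → ≡.refl
    3F 0F → ≡.refl
    3F 1F → ≡.refl
    3F 2F → ≡.refl
    3F 3F → ≡.refl

I₃-2-2-0 : let open Tripartite 2 2 0 in
  I₃ ≐ ⟨ x 1F * y 1F ∷ x 0F + x 1F ∷ y 0F + y 1F ∷ [] ⟩
I₃-2-2-0 = square-minors⊆ L≡M , ⊆square-minors L≡M
  where
  open CompleteTripartite 2 2 0
  open Square (x 0F) (x 1F) (y 0F) (y 1F)

  L≡M : ∀ i j → L i j ≡ M i j
  L≡M = λ where
    0F 0F → ≡.refl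
    0F 1F → ≡.refl
    0F 2F → ≡.refl
    0F 3F → ≡.refl
    1F 0F → ≡.refl
    1F 1F → ≡.refl
    1F 2F → ≡.refl
    1F 3F → ≡.refl
    2F 0F → ≡.refl
    2F 1F → ≡.refl
    2F 2F → ≡.refl
    2F 3F → ≡.refl
    3F 0F → ≡.refl
    3F 1F → ≡.refl
    3F 2F → ≡.refl
    3F 3F → ≡.refl

theorem4p4 : (∀ m n o → let open Tripartite m n o in
    Admissible → m ≥ 2 → n ≥ 2 → o ≥ 2 →
    I₃ ≐ ⟨ con (+ 2) ∷ xs ++ ys ++ zs ⟩)
    ×
    (∀ m n → let open Tripartite m n 1 in
    Admissible → m ≥ 2 → n ≥ 2 →
    I₃ ≐ ⟨ xs ++ ys ++ [ z 0F + con (+ 2) ] ⟩)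
    ×
    (∀ m → let open Tripartite m 1 1 in
    Admissible → m ≥ 3 →
    I₃ ≐ ⟨ xs ++ [ y 0F + z 0F + con (+ 2) ] ⟩)
    ×
    (let open Tripartite 2 1 1 in
    Admissible →
    I₃ ≐ ⟨ x 0F * x 1F + x 0F + x 1F
    ∷ x 0F * z 0F + x 0F
    ∷ x 1F * z 0F + x 1F
    ∷ y 0F + z 0F + con (+ 2)
    ∷ [] ⟩)
    ×
    (∀ m n → let open Tripartite m n 0 in
    Admissible → m ≥ 3 → n ≥ 3 →
    I₃ ≐ ⟨ xs ++ ys ⟩)
    ×
    (∀ m → let open Tripartite m 2 0 in
    Admissible → m ≥ 3 →
    I₃ ≐ ⟨ xs ++ [ y 0F + y 1F ] ⟩)
    ×
    (let open Tripartite 2 2 0 in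
    Admissible →
    I₃ ≐ ⟨ x 1F * y 1F ∷ x 0F + x 1F ∷ y 0F + y 1F ∷ [] ⟩)
    ×
    (∀ m → let open Tripartite m 1 0 in
    Admissible → m ≥ 3 →
    I₃ ≐ ⟨ xs ⟩)
theorem4p4 =
  (λ m n o _ → I₃-≥2-≥2-≥2 m n o) ,
  (λ m n _ → I₃-≥2-≥2-1 m n) ,
  (λ m _ → I₃-≥3-1-1 m) ,
  (λ _ → I₃-2-1-1) ,
  (λ m n _ → I₃-≥3-≥3-0 m n) ,
  (λ m _ → I₃-≥3-2-0 m) ,
  (λ _ → I₃-2-2-0) ,
  (λ m _ → I₃-≥3-1-0 m)
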